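{- Let $\pi$ be a type derivation of a judgment $J$ whose last rule has as premises the derivations $\pi_1,\dots,\pi_n$ of judgments $J_1,\dots,J_n$ ($n\ge1$). If $\pi_1,\dots,\pi_n$ are compatible, then $$[\![\pi]\!]=\sum_{\mathbb Z}\Big(\bigodot_{i}[\![\pi_i]\!]\Big),\qquad\text{where }\ \mathbb Z=\bigcup_i\mathrm{Nm}([\![\pi_i]\!])-\mathrm{Nm}(J).$$
   Context: **Terms.** Terms $t,u$ and values $v,w$ (up to $\alpha$-equivalence): $t,u ::= v \mid \mathsf{sample}_d \mid \mathsf{case}\ v\ \mathsf{of}\ \{v_i\Rightarrow \mathsf{sample}_{d_i}\} \mid \mathsf{obs}(x=b) \mid \mathsf{let}\ x=u\ \mathsf{in}\ t \mid \mathsf{letp}\ \langle x,y\rangle=v\ \mathsf{in}\ t \mid t\,v\mid \lambda x.t\mid \mathsf{der}\,v$; $v,w ::= x \mid \langle v,w\rangle \mid\ !t \mid b$; $b::=\mathtt t\mid\mathtt f$; $d$ ranges over probability distributions on $\{\mathtt t,\mathtt f\}$. $\mathsf c\langle y_1,\dots,y_n\rangle$ abbreviates $\mathsf{case}\ \langle y_1,\dots,y_n\rangle\ \mathsf{of}\ \{\bar b\Rightarrow\mathsf{sample}_{d_{\bar b}}\}_{\bar b\in\{\mathtt t,\mathtt f\}^n}$. **Intersection types.** Fix a countable set of names $X,Y,Z,\dots$. Ground types $K,L::=X\mid K\otimes L$; positive types $P,Q::=L\mid[A_1,\dots,A_n]$ (finite multiset, $n\ge0$); types $A,B::=P\mid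 P\multimap A$. A typing context is a total map from variables to positive types with all but finitely many variables mapped to $[]$; it splits into its ground part $\Lambda$ and its multiset part $\Gamma$; $\uplus$ is (pointwise) multiset union. $\mathrm{Nm}(\cdot)$ is the set of names occurring in a type, context, judgment or derivation. Rules (premises $\Longrightarrow$ conclusion): - (i-sample) $\Lambda\vdash\mathsf{sample}_d:X$ if $X\notin\mathrm{Nm}(\Lambda)$. - (i-cond) $\Lambda,y_1:Y_1,\dots,y_n:Y_n\vdash\mathsf c\langle y_1,\dots,y_n\rangle:X$ if $X\notin\{Y_1,\dots,Y_n\}$ and $X\notin\mathrm{Nm}(\Lambda)$. - (i-var) $\Lambda,x:P\vdash x:P$. - (i-let) $\Lambda,\Gamma_1\vdash u:P$ and $\Lambda,\Gamma_2,x:P\vdash t:A$ $\Longrightarrow$ $\Lambda,\Gamma_1\uplus\Gamma_2\vdash\mathsf{let}\ x=u\ \mathsf{in}\ t:A$. - (i-pair) $\Lambda\vdash v:L_1$ and $\Lambda\vdash w:L_2$ $\Longrightarrow$ $\Lambda\vdash\langle v,w\rangle:L_1\otimes L_2$. - (i-letp) $\Lambda\vdash v:L_1\otimes L_2$ and $\Lambda,x:L_1,y:L_2,\Gamma\vdash t:A$ $\Longrightarrow$ $\Lambda,\Gamma\vdash\mathsf{letp}\ \langle x,y\rangle=v\ \mathsf{in}\ t:A$. - (i-abs) $\Lambda,\Gamma,x:P\vdash t:A$ $\Longrightarrow$ $\Lambda,\Gamma\vdash\lambda x.t:P\multimap A$. - (i-app) $\Lambda,\Gamma_1\vdash t:P\multimap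 A$ and $\Lambda,\Gamma_2\vdash v:P$ $\Longrightarrow$ $\Lambda,\Gamma_1\uplus\Gamma_2\vdash t\,v:A$. - (i-bang) $(\Lambda,\Gamma_i\vdash t:A_i)_{i=1}^n$, $n\ge0$ $\Longrightarrow$ $\Lambda,\biguplus_i\Gamma_i\vdash\,!t:[A_1,\dots,A_n]$. - (i-der) $\Lambda,\Gamma\vdash v:[A]$ $\Longrightarrow$ $\Lambda,\Gamma\vdash\mathsf{der}\,v:A$. Axioms (i-sample), (i-cond) are the *probabilistic axioms*; the name $X$ typing the subject is their *main name*. Naming condition (part of the definition of a derivation): main names are pairwise distinct. **Factors.** $\mathrm{Val}(X)=\{\mathtt t,\mathtt f\}$ for each name; for a finite set of names $\mathbb X$, $\mathrm{Val}(\mathbb X)=\prod_{X\in\mathbb X}\mathrm{Val}(X)$, and $\bar x|_{\mathbb Y}$ is restriction to $\mathbb Y\subseteq\mathbb X$. A factor over $\mathbb X$ is a function $\phi:\mathrm{Val}(\mathbb X)\to\mathbb R_{\ge0}$; $\mathrm{Nm}(\phi)=\mathbb X$. Sum out: for $\mathbb Z\subseteq\mathbb X$, $\sum_{\mathbb Z}\phi$ is the factor over $\mathbb X-\mathbb Z$ with $(\sum_{\mathbb Z}\phi)(\bar y)=\sum_{\bar z\in\mathrm{Val}(\mathbb Z)}\phi(\bar z\bar y)$. Product: $(\phi_1\odot\phi_2)(\bar z)=\phi_1(\bar z|_{\mathrm{Nm}(\phi_1)})\,\phi_2(\bar z|_{\mathrm{Nm}(\phi_2)})$, a factor over $\mathrm{Nm}(\phi_1)\cup\mathrm{Nm}(\phi_2)$;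 the empty product is the factor over $\emptyset$ with value $1$. **Semantics of a derivation.** To $\Lambda\vdash\mathsf{sample}_d:X$ is associated the factor over $\{X\}$ with $\phi(x)=d(x)$; to an (i-cond) axiom $\Lambda,y_1:Y_1,\dots,y_n:Y_n\vdash\mathsf{case}\ \langle y_1,\dots,y_n\rangle\ \mathsf{of}\ \{\bar b\Rightarrow\mathsf{sample}_{d_{\bar b}}\}_{\bar b\in\{\mathtt t,\mathtt f\}^n}:X$ is associated the factor over $\mathbb Y\cup\{X\}$, $\mathbb Y=\{Y_1,\dots,Y_n\}$, with $\phi(\bar y\,x)=d_{\langle\bar y|_{Y_1},\dots,\bar y|_{Y_n}\rangle}(x)$. For a derivation $\pi$ of a judgment $J$, let $\mathrm{Cpts}(\pi)$ be the family of factors associated with its probabilistic axioms and $\mathbb X=\bigcup_{\phi\in\mathrm{Cpts}(\pi)}\mathrm{Nm}(\phi)$; then $[\![\pi]\!]=\sum_{\mathbb X-\mathrm{Nm}(J)}\big(\bigodot_{\phi\in\mathrm{Cpts}(\pi)}\phi\big)$. **Compatibility.** Derivations $\pi_1,\dots,\pi_n$ of $J_1,\dots,J_n$ are *compatible* if for every name $Z$ and every $j$: if $Z\in\mathrm{Nm}(\pi_j)$ and $Z\notin\mathrm{Nm}(J_j)$, then $Z\notin\mathrm{Nm}(\pi_i)$ for all $i\ne j$. -}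

module Defs where

open import Algebra.Bundles using (CommutativeSemiring)
open import Data.Bool.Base using (Bool; true; false)
open import Data.Fin.Base using (Fin; zero; suc)
open import Data.List.Base as List using (List; []; _∷_; _++_; concat; deduplicate; filter; foldr; map)
open import Data.List.Membership.Propositional using (_∈_; _∉_)
open import Data.List.Membership.DecPropositional as DecMembership using ()
open import Data.List.Membership.Propositional.Properties
  using (∈-++⁺ˡ; ∈-++⁺ʳ; ∈-deduplicate⁺; ∈-filter⁺; ∈-filter⁻)
open import Data.List.Properties using (map-++)
open import Data.List.Relation.Binary.Permutation.Homogeneous using (Permutation)
open import Data.List.Relation.Binary.Pointwise.Base using (Pointwise; []; _∷_)
open import Data.List.Relation.Unary.All as All using (All; []; _∷_)
import Data.List.Relation.Unary.All.Properties as All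
import Data.List.Relation.Binary.Subset.Propositional as List
open import Data.List.Relation.Unary.AllPairs using ([]; _∷_)
open import Data.List.Relation.Unary.Any using (here)
open import Data.List.Relation.Unary.Unique.Propositional using (Unique)
open import Data.List.Relation.Unary.Unique.DecPropositional.Properties using (deduplicate-!)
import Data.List.Relation.Unary.Unique.Propositional.Properties as Unique
import Data.Nat.Base as ℕ
open import Data.Nat.Base using (ℕ; zero; suc; _⊔_)
import Data.Nat.Properties as ℕ
open import Data.Product.Base using (∃; _×_; _,_; proj₁; proj₂)
open import Data.Rational.Base as ℚ using (ℚ; 0ℚ; 1ℚ; ∣_∣; 1/_)
import Data.Rational.Properties as ℚ
open import Data.Sum.Base using (inj₁; inj₂)
open import Data.Vec.Base as Vec using (Vec; []; _∷_; lookup; tabulate; toList)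
open import Data.Vec.Membership.Propositional.Properties using (∈-lookup; ∈-toList⁺)
open import Function.Base using (_∘_; const)
open import Level using (0ℓ)
open import Relation.Binary.PropositionalEquality.Core using (_≡_; _≢_; refl; sym; trans; cong; cong₂; subst)
open import Relation.Nullary using (yes; no; ¬?)

------------------------------------------------------------------------
-- Non-negative reals

-- ℝ≥0 is the Cauchy completion of ℚ≥0.  (A Cauchy sequence of rationals whose
-- limit is ≥ 0 has the same limit as its termwise maximum with 0, so
-- restricting to sequences of non-negative rationals loses nothing.)

module Real where

  -- One relation serves both purposes: a ~ a says that a is a Cauchy sequence,
  -- and for Cauchy a and b, a ~ b says that a and b have the same limit.
  record _~_ (a b : ℕ → ℚ) : Set where
    constructor lim
    field
      within : ∀ ε → 0ℚ ℚ.< ε → ∃ λ N → ∀ m n → N ℕ.≤ m → N ℕ.≤ n → ∣ a m ℚ.- b n ∣ ℚ.≤ ε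
  open _~_

  record ℝ⁺ : Set where
    field
      seq    : ℕ → ℚ
      nonNeg : ∀ n → 0ℚ ℚ.≤ seq n
      cauchy : seq ~ seq
  open ℝ⁺

  _≈_ : ℝ⁺ → ℝ⁺ → Set
  x ≈ y = seq x ~ seq y

  private

    ∣-∣-flip : ∀ p q → ∣ p ℚ.- q ∣ ≡ ∣ q ℚ.- p ∣
    ∣-∣-flip p q = trans (sym (ℚ.∣-p∣≡∣p∣ (p ℚ.- q))) (cong ∣_∣ (⁻¹-anti-homo‿- p q))
      where open import Algebra.Properties.AbelianGroup ℚ.+-0-abelianGroup using (⁻¹-anti-homo‿-)

    p≡[p-q]+q : ∀ p q → p ≡ (p ℚ.- q) ℚ.+ q
    p≡[p-q]+q p q = sym (trans (ℚ.+-assoc p (ℚ.- q) q)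
                               (trans (cong (p ℚ.+_) (ℚ.+-inverseˡ q)) (ℚ.+-identityʳ p)))

    p-r≡[p-q]+[q-r] : ∀ p q r → p ℚ.- r ≡ (p ℚ.- q) ℚ.+ (q ℚ.- r)
    p-r≡[p-q]+[q-r] p q r = trans (cong (ℚ._- r) (p≡[p-q]+q p q)) (ℚ.+-assoc (p ℚ.- q) q (ℚ.- r))

    [p+r]-[q+s]≡[p-q]+[r-s] : ∀ p q r s → (p ℚ.+ r) ℚ.- (q ℚ.+ s) ≡ (p ℚ.- q) ℚ.+ (r ℚ.- s)
    [p+r]-[q+s]≡[p-q]+[r-s] p q r s =
      trans (cong ((p ℚ.+ r) ℚ.+_) (ℚ.neg-distrib-+ q s)) (interchange p r (ℚ.- q) (ℚ.- s))
      where
      open import Algebra.Bundles using (CommutativeMonoid)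
      open import Algebra.Properties.CommutativeSemigroup
        (CommutativeMonoid.commutativeSemigroup ℚ.+-0-commutativeMonoid) using (interchange)

    p*r-p*s≡p*[r-s] : ∀ p r s → p ℚ.* r ℚ.- p ℚ.* s ≡ p ℚ.* (r ℚ.- s)
    p*r-p*s≡p*[r-s] p r s = sym (trans (ℚ.*-distribˡ-+ p r (ℚ.- s))
                                       (cong (p ℚ.* r ℚ.+_) (sym (ℚ.neg-distribʳ-* p s))))

    p*r-q*s≡p*[r-s]+s*[p-q] : ∀ p q r s → p ℚ.* r ℚ.- q ℚ.* s ≡ p ℚ.* (r ℚ.- s) ℚ.+ s ℚ.* (p ℚ.- q)
    p*r-q*s≡p*[r-s]+s*[p-q] p q r s =
      trans (p-r≡[p-q]+[q-r] (p ℚ.* r) (p ℚ.* s) (q ℚ.* s))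
            (cong₂ ℚ._+_ (p*r-p*s≡p*[r-s] p r s)
                         (trans (cong₂ ℚ._-_ (ℚ.*-comm p s) (ℚ.*-comm q s)) (p*r-p*s≡p*[r-s] s p q)))

    ~-sym : ∀ {a b} → a ~ b → b ~ a
    within (~-sym {a} {b} ab) ε ε>0 with N , h ← within ab ε ε>0 =
      N , λ m n N≤m N≤n → subst (ℚ._≤ ε) (∣-∣-flip (a n) (b m)) (h n m N≤n N≤m)

    -- The estimates below split ε as c ℚ.* δ for a given c > 0.
    split : ∀ c ε → 0ℚ ℚ.< c → 0ℚ ℚ.< ε → ∃ λ δ → 0ℚ ℚ.< δ × c ℚ.* δ ≡ ε
    split c ε c>0 ε>0 = (1/ c) ℚ.* ε , ℚ.positive⁻¹ ((1/ c) ℚ.* ε) , eq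
      where
      instance
        _ = ℚ.positive c>0
        _ = ℚ.positive ε>0
        _ = ℚ.pos⇒nonZero c
        _ = ℚ.1/pos⇒pos c
        _ = ℚ.pos*pos⇒pos (1/ c) ε
      eq : c ℚ.* ((1/ c) ℚ.* ε) ≡ ε
      eq = trans (sym (ℚ.*-assoc c (1/ c) ε)) (trans (cong (ℚ._* ε) (ℚ.*-inverseʳ c)) (ℚ.*-identityˡ ε))

    0<1 : 0ℚ ℚ.< 1ℚ
    0<1 = ℚ.positive⁻¹ 1ℚ

    2ℚ : ℚ
    2ℚ = 1ℚ ℚ.+ 1ℚ

    halve : ∀ ε → 0ℚ ℚ.< ε → ∃ λ δ → 0ℚ ℚ.< δ × δ ℚ.+ δ ≡ ε
    halve ε ε>0 with δ , δ>0 , eq ← split 2ℚ ε (ℚ.positive⁻¹ 2ℚ) ε>0 =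
      δ , δ>0 , trans (sym (trans (ℚ.*-distribʳ-+ δ 1ℚ 1ℚ) (cong₂ ℚ._+_ (ℚ.*-identityˡ δ) (ℚ.*-identityˡ δ)))) eq

    ~-trans : ∀ {a b c} → a ~ b → b ~ c → a ~ c
    within (~-trans {a} {b} {c} ab bc) ε ε>0
      with δ , δ>0 , δ+δ≡ε ← halve ε ε>0
      with N , h ← within ab δ δ>0
      with M , k ← within bc δ δ>0 = N ⊔ M , bound
      where
      open ℚ.≤-Reasoning
      bound : ∀ m n → N ⊔ M ℕ.≤ m → N ⊔ M ℕ.≤ n → ∣ a m ℚ.- c n ∣ ℚ.≤ ε
      bound m n ≤m ≤n = begin
        ∣ a m ℚ.- c n ∣
          ≡⟨ cong ∣_∣ (p-r≡[p-q]+[q-r] (a m) (b (N ⊔ M)) (c n)) ⟩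
        ∣ (a m ℚ.- b (N ⊔ M)) ℚ.+ (b (N ⊔ M) ℚ.- c n) ∣
          ≤⟨ ℚ.∣p+q∣≤∣p∣+∣q∣ (a m ℚ.- b (N ⊔ M)) (b (N ⊔ M) ℚ.- c n) ⟩
        ∣ a m ℚ.- b (N ⊔ M) ∣ ℚ.+ ∣ b (N ⊔ M) ℚ.- c n ∣
          ≤⟨ ℚ.+-mono-≤ (h m (N ⊔ M) (ℕ.m⊔n≤o⇒m≤o N M ≤m) (ℕ.m≤m⊔n N M))
                        (k (N ⊔ M) n (ℕ.m≤n⊔m N M) (ℕ.m⊔n≤o⇒n≤o N M ≤n)) ⟩
        δ ℚ.+ δ
          ≡⟨ δ+δ≡ε ⟩
        ε ∎

    ~-+ : ∀ {a a′ b b′} → a ~ a′ → b ~ b′ → (λ n → a n ℚ.+ b n) ~ (λ n → a′ n ℚ.+ b′ n)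
    within (~-+ {a} {a′} {b} {b′} aa′ bb′) ε ε>0
      with δ , δ>0 , δ+δ≡ε ← halve ε ε>0
      with N , h ← within aa′ δ δ>0
      with M , k ← within bb′ δ δ>0 = N ⊔ M , bound
      where
      open ℚ.≤-Reasoning
      bound : ∀ m n → N ⊔ M ℕ.≤ m → N ⊔ M ℕ.≤ n → ∣ (a m ℚ.+ b m) ℚ.- (a′ n ℚ.+ b′ n) ∣ ℚ.≤ ε
      bound m n ≤m ≤n = begin
        ∣ (a m ℚ.+ b m) ℚ.- (a′ n ℚ.+ b′ n) ∣
          ≡⟨ cong ∣_∣ ([p+r]-[q+s]≡[p-q]+[r-s] (a m) (a′ n) (b m) (b′ n)) ⟩
        ∣ (a m ℚ.- a′ n) ℚ.+ (b m ℚ.- b′ n) ∣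
          ≤⟨ ℚ.∣p+q∣≤∣p∣+∣q∣ (a m ℚ.- a′ n) (b m ℚ.- b′ n) ⟩
        ∣ a m ℚ.- a′ n ∣ ℚ.+ ∣ b m ℚ.- b′ n ∣
          ≤⟨ ℚ.+-mono-≤ (h m n (ℕ.m⊔n≤o⇒m≤o N M ≤m) (ℕ.m⊔n≤o⇒m≤o N M ≤n))
                        (k m n (ℕ.m⊔n≤o⇒n≤o N M ≤m) (ℕ.m⊔n≤o⇒n≤o N M ≤n)) ⟩
        δ ℚ.+ δ
          ≡⟨ δ+δ≡ε ⟩
        ε ∎

    bounded : ∀ {a b} → a ~ b → (∀ n → 0ℚ ℚ.≤ b n) →
              ∃ λ N → ∃ λ B → 0ℚ ℚ.< B × (∀ n → N ℕ.≤ n → a n ℚ.≤ B)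
    bounded {a} {b} ab b≥0 with N , h ← within ab 1ℚ 0<1 = N , 1ℚ ℚ.+ b N , B>0 , bound
      where
      open ℚ.≤-Reasoning
      B>0 : 0ℚ ℚ.< 1ℚ ℚ.+ b N
      B>0 = ℚ.+-mono-<-≤ 0<1 (b≥0 N)
      p≤∣p∣ : ∀ p → p ℚ.≤ ∣ p ∣
      p≤∣p∣ p with ℚ.≤-total 0ℚ p
      ... | inj₁ 0≤p = ℚ.≤-reflexive (sym (ℚ.0≤p⇒∣p∣≡p 0≤p))
      ... | inj₂ p≤0 = ℚ.≤-trans p≤0 (ℚ.0≤∣p∣ p)
      bound : ∀ n → N ℕ.≤ n → a n ℚ.≤ 1ℚ ℚ.+ b N
      bound n N≤n = begin
        a n                     ≡⟨ p≡[p-q]+q (a n) (b N) ⟩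
        (a n ℚ.- b N) ℚ.+ b N   ≤⟨ ℚ.+-mono-≤ (p≤∣p∣ (a n ℚ.- b N)) (ℚ.≤-refl {b N}) ⟩
        ∣ a n ℚ.- b N ∣ ℚ.+ b N ≤⟨ ℚ.+-mono-≤ (h n N N≤n ℕ.≤-refl) (ℚ.≤-refl {b N}) ⟩
        1ℚ ℚ.+ b N              ∎

    ∣p*q∣≤C*δ : ∀ p q C δ → 0ℚ ℚ.≤ p → p ℚ.≤ C → 0ℚ ℚ.≤ δ → ∣ q ∣ ℚ.≤ δ → ∣ p ℚ.* q ∣ ℚ.≤ C ℚ.* δ
    ∣p*q∣≤C*δ p q C δ 0≤p p≤C 0≤δ q≤δ = begin
      ∣ p ℚ.* q ∣     ≡⟨ ℚ.∣p*q∣≡∣p∣*∣q∣ p q ⟩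
      ∣ p ∣ ℚ.* ∣ q ∣ ≡⟨ cong (ℚ._* ∣ q ∣) (ℚ.0≤p⇒∣p∣≡p 0≤p) ⟩
      p ℚ.* ∣ q ∣     ≤⟨ ℚ.*-monoˡ-≤-nonNeg p {{ℚ.nonNegative 0≤p}} q≤δ ⟩
      p ℚ.* δ         ≤⟨ ℚ.*-monoʳ-≤-nonNeg δ {{ℚ.nonNegative 0≤δ}} p≤C ⟩
      C ℚ.* δ         ∎
      where open ℚ.≤-Reasoning

    ∣p*r-q*s∣≤[A+B]*δ : ∀ p q r s A B δ →
      0ℚ ℚ.≤ p → p ℚ.≤ A → 0ℚ ℚ.≤ s → s ℚ.≤ B → 0ℚ ℚ.≤ δ →
      ∣ r ℚ.- s ∣ ℚ.≤ δ → ∣ p ℚ.- q ∣ ℚ.≤ δ → ∣ p ℚ.* r ℚ.- q ℚ.* s ∣ ℚ.≤ (A ℚ.+ B) ℚ.* δ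
    ∣p*r-q*s∣≤[A+B]*δ p q r s A B δ 0≤p p≤A 0≤s s≤B 0≤δ r-s≤δ p-q≤δ = begin
      ∣ p ℚ.* r ℚ.- q ℚ.* s ∣
        ≡⟨ cong ∣_∣ (p*r-q*s≡p*[r-s]+s*[p-q] p q r s) ⟩
      ∣ p ℚ.* (r ℚ.- s) ℚ.+ s ℚ.* (p ℚ.- q) ∣
        ≤⟨ ℚ.∣p+q∣≤∣p∣+∣q∣ (p ℚ.* (r ℚ.- s)) (s ℚ.* (p ℚ.- q)) ⟩
      ∣ p ℚ.* (r ℚ.- s) ∣ ℚ.+ ∣ s ℚ.* (p ℚ.- q) ∣
        ≤⟨ ℚ.+-mono-≤ (∣p*q∣≤C*δ p (r ℚ.- s) A δ 0≤p p≤A 0≤δ r-s≤δ) (∣p*q∣≤C*δ s (p ℚ.- q) B δ 0≤s s≤B 0≤δ p-q≤δ) ⟩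
      A ℚ.* δ ℚ.+ B ℚ.* δ
        ≡⟨ sym (ℚ.*-distribʳ-+ δ A B) ⟩
      (A ℚ.+ B) ℚ.* δ ∎
      where open ℚ.≤-Reasoning

    ~-* : ∀ {a a′ b b′} →
          (∀ n → 0ℚ ℚ.≤ a n) → (∀ n → 0ℚ ℚ.≤ a′ n) → (∀ n → 0ℚ ℚ.≤ b n) → (∀ n → 0ℚ ℚ.≤ b′ n) →
          a ~ a′ → b ~ b′ → (λ n → a n ℚ.* b n) ~ (λ n → a′ n ℚ.* b′ n)
    within (~-* {a} {a′} {b} {b′} a≥0 a′≥0 b≥0 b′≥0 aa′ bb′) ε ε>0 =
      product (bounded aa′ a′≥0) (bounded (~-sym bb′) b≥0)
      where
      product : (∃ λ K → ∃ λ A → 0ℚ ℚ.< A × (∀ n → K ℕ.≤ n → a n ℚ.≤ A)) →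
                (∃ λ L → ∃ λ B → 0ℚ ℚ.< B × (∀ n → L ℕ.≤ n → b′ n ℚ.≤ B)) →
                ∃ λ N → ∀ m n → N ℕ.≤ m → N ℕ.≤ n → ∣ a m ℚ.* b m ℚ.- a′ n ℚ.* b′ n ∣ ℚ.≤ ε
      product (K , A , A>0 , a≤A) (L , B , B>0 , b′≤B) = (K ⊔ L) ⊔ (N ⊔ M) , bound
        where
        δ-split = split (A ℚ.+ B) ε (ℚ.+-mono-< A>0 B>0) ε>0
        δ   = proj₁ δ-split
        δ>0 = proj₁ (proj₂ δ-split)
        N   = proj₁ (within aa′ δ δ>0)
        M   = proj₁ (within bb′ δ δ>0)
        bound : ∀ m n → (K ⊔ L) ⊔ (N ⊔ M) ℕ.≤ m → (K ⊔ L) ⊔ (N ⊔ M) ℕ.≤ n →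
                ∣ a m ℚ.* b m ℚ.- a′ n ℚ.* b′ n ∣ ℚ.≤ ε
        bound m n ≤m ≤n =
          subst (∣ a m ℚ.* b m ℚ.- a′ n ℚ.* b′ n ∣ ℚ.≤_) (proj₂ (proj₂ δ-split))
            (∣p*r-q*s∣≤[A+B]*δ (a m) (a′ n) (b m) (b′ n) A B δ
              (a≥0 m) (a≤A m (ℕ.m⊔n≤o⇒m≤o K L KL≤m)) (b′≥0 n) (b′≤B n (ℕ.m⊔n≤o⇒n≤o K L KL≤n)) (ℚ.<⇒≤ δ>0)
              (proj₂ (within bb′ δ δ>0) m n (ℕ.m⊔n≤o⇒n≤o N M NM≤m) (ℕ.m⊔n≤o⇒n≤o N M NM≤n))
              (proj₂ (within aa′ δ δ>0) m n (ℕ.m⊔n≤o⇒m≤o N M NM≤m) (ℕ.m⊔n≤o⇒m≤o N M NM≤n)))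
          where
          KL≤m = ℕ.m⊔n≤o⇒m≤o (K ⊔ L) (N ⊔ M) ≤m
          KL≤n = ℕ.m⊔n≤o⇒m≤o (K ⊔ L) (N ⊔ M) ≤n
          NM≤m = ℕ.m⊔n≤o⇒n≤o (K ⊔ L) (N ⊔ M) ≤m
          NM≤n = ℕ.m⊔n≤o⇒n≤o (K ⊔ L) (N ⊔ M) ≤n

    ~-const : ∀ p → const p ~ const p
    within (~-const p) ε ε>0 = 0 , λ _ _ _ _ → ℚ.≤-trans (ℚ.≤-reflexive (cong ∣_∣ (ℚ.+-inverseʳ p))) (ℚ.<⇒≤ ε>0)

    termwise : ∀ x y → (∀ n → seq x n ≡ seq y n) → x ≈ y
    within (termwise x y eq) ε ε>0 with N , h ← within (cauchy x) ε ε>0 =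
      N , λ m n N≤m N≤n → subst (λ p → ∣ seq x m ℚ.- p ∣ ℚ.≤ ε) (eq n) (h m n N≤m N≤n)

  _+_ : ℝ⁺ → ℝ⁺ → ℝ⁺
  x + y = record
    { seq    = λ n → seq x n ℚ.+ seq y n
    ; nonNeg = λ n → ℚ.+-mono-≤ (nonNeg x n) (nonNeg y n)
    ; cauchy = ~-+ (cauchy x) (cauchy y)
    }

  _*_ : ℝ⁺ → ℝ⁺ → ℝ⁺
  x * y = record
    { seq    = λ n → seq x n ℚ.* seq y n
    ; nonNeg = λ n → ℚ.nonNegative⁻¹ _ {{ℚ.nonNeg*nonNeg⇒nonNeg (seq x n) {{ℚ.nonNegative (nonNeg x n)}}
                                                                (seq y n) {{ℚ.nonNegative (nonNeg y n)}}}}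
    ; cauchy = ~-* (nonNeg x) (nonNeg x) (nonNeg y) (nonNeg y) (cauchy x) (cauchy y)
    }

  0# : ℝ⁺
  0# = record { seq = const 0ℚ ; nonNeg = λ _ → ℚ.≤-refl ; cauchy = ~-const 0ℚ }

  1# : ℝ⁺
  1# = record { seq = const 1ℚ ; nonNeg = λ _ → ℚ.<⇒≤ 0<1 ; cauchy = ~-const 1ℚ }

  ℝ≥0 : CommutativeSemiring 0ℓ 0ℓ
  ℝ≥0 = record
    { Carrier = ℝ⁺ ; _≈_ = _≈_ ; _+_ = _+_ ; _*_ = _*_ ; 0# = 0# ; 1# = 1#
    ; isCommutativeSemiring = isCommutativeSemiringˡ (record
      { +-isCommutativeMonoid = record
        { isMonoid = record
          { isSemigroup = record
            { isMagma = record { isEquivalence = ≈-isEquivalence ; ∙-cong = ~-+ }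
            ; assoc   = λ x y z → termwise ((x + y) + z) (x + (y + z))
                                    (λ n → ℚ.+-assoc (seq x n) (seq y n) (seq z n))
            }
          ; identity = (λ x → termwise (0# + x) x (λ n → ℚ.+-identityˡ (seq x n)))
                     , (λ x → termwise (x + 0#) x (λ n → ℚ.+-identityʳ (seq x n)))
          }
        ; comm = λ x y → termwise (x + y) (y + x) (λ n → ℚ.+-comm (seq x n) (seq y n))
        }
      ; *-isCommutativeMonoid = record
        { isMonoid = record
          { isSemigroup = record
            { isMagma = record
              { isEquivalence = ≈-isEquivalence
              ; ∙-cong = λ {x} {y} {u} {v} → ~-* (nonNeg x) (nonNeg y) (nonNeg u) (nonNeg v)
              }
            ; assoc   = λ x y z → termwise ((x * y) * z) (x * (y * z))
                                    (λ n → ℚ.*-assoc (seq x n) (seq y n) (seq z n))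
            }
          ; identity = (λ x → termwise (1# * x) x (λ n → ℚ.*-identityˡ (seq x n)))
                     , (λ x → termwise (x * 1#) x (λ n → ℚ.*-identityʳ (seq x n)))
          }
        ; comm = λ x y → termwise (x * y) (y * x) (λ n → ℚ.*-comm (seq x n) (seq y n))
        }
      ; distribʳ = λ x y z → termwise ((y + z) * x) ((y * x) + (z * x))
                               (λ n → ℚ.*-distribʳ-+ (seq x n) (seq y n) (seq z n))
      ; zeroˡ = λ x → termwise (0# * x) 0# (λ n → ℚ.*-zeroˡ (seq x n))
      })
    }
    where
    open import Algebra.Structures.Biased _≈_ using (isCommutativeSemiringˡ)
    open import Relation.Binary.Structures using (IsEquivalence)
    ≈-isEquivalence : IsEquivalence _≈_
    ≈-isEquivalence = record { refl = λ {x} → cauchy x ; sym = ~-sym ; trans = ~-trans }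

open Real public using (ℝ≥0)

------------------------------------------------------------------------
-- Finite sets of names and their valuations

Name : Set
Name = ℕ

open DecMembership ℕ._≟_ using (_∈?_)

record NameSet : Set where
  constructor _,!_
  field
    elements : List Name
    unique   : Unique elements
open NameSet public

infix 4 _∈ˢ_ _∉ˢ_ _⊆_
infixl 6 _∪_ _∖_

_∈ˢ_ _∉ˢ_ : Name → NameSet → Set
X ∈ˢ 𝕏 = X ∈ elements 𝕏
X ∉ˢ 𝕏 = X ∉ elements 𝕏

_⊆_ : NameSet → NameSet → Set
𝕏 ⊆ 𝕐 = elements 𝕏 List.⊆ elements 𝕐

⌈_⌉ : List Name → NameSet
⌈ Xs ⌉ = deduplicate ℕ._≟_ Xs ,! deduplicate-! ℕ._≟_ Xs

_∪_ : NameSet → NameSet → NameSet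
𝕏 ∪ 𝕐 = ⌈ elements 𝕏 ++ elements 𝕐 ⌉

⋃ : List NameSet → NameSet
⋃ = foldr _∪_ ⌈ [] ⌉

_∖_ : NameSet → NameSet → NameSet
𝕏 ∖ 𝕐 = filter (λ X → ¬? (X ∈? elements 𝕐)) (elements 𝕏) ,! Unique.filter⁺ _ (unique 𝕏)

∈⌈⌉⁺ : ∀ Xs → Xs List.⊆ elements ⌈ Xs ⌉
∈⌈⌉⁺ Xs = ∈-deduplicate⁺ ℕ._≟_

⊆-∪ˡ : ∀ 𝕏 𝕐 → 𝕏 ⊆ 𝕏 ∪ 𝕐
⊆-∪ˡ 𝕏 𝕐 = ∈⌈⌉⁺ (elements 𝕏 ++ elements 𝕐) ∘ ∈-++⁺ˡ

⊆-∪ʳ : ∀ 𝕏 𝕐 → 𝕐 ⊆ 𝕏 ∪ 𝕐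
⊆-∪ʳ 𝕏 𝕐 = ∈⌈⌉⁺ (elements 𝕏 ++ elements 𝕐) ∘ ∈-++⁺ʳ (elements 𝕏)

∈∖⁺ : ∀ 𝕏 𝕐 {X} → X ∈ˢ 𝕏 → X ∉ˢ 𝕐 → X ∈ˢ 𝕏 ∖ 𝕐
∈∖⁺ 𝕏 𝕐 = ∈-filter⁺ (λ X → ¬? (X ∈? elements 𝕐))

∖-⊆ : ∀ 𝕏 𝕐 → 𝕏 ∖ 𝕐 ⊆ 𝕏
∖-⊆ 𝕏 𝕐 = proj₁ ∘ ∈-filter⁻ (λ X → ¬? (X ∈? elements 𝕐))

-- Val 𝕏 is ∏_{X ∈ 𝕏} {t,f}: one boolean per element of 𝕏, and 𝕏 has no repetitions.
Valᴸ : List Name → Set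
Valᴸ = All (const Bool)

Val : NameSet → Set
Val 𝕏 = Valᴸ (elements 𝕏)

_↾_ : ∀ {Xs Ys} → Valᴸ Xs → Ys List.⊆ Xs → Valᴸ Ys
x̄ ↾ Ys⊆Xs = All.tabulate (All.lookup x̄ ∘ Ys⊆Xs)

-- The valuation z̄ȳ of 𝕏.
combine : ∀ 𝕏 ℤ → Val ℤ → Val (𝕏 ∖ ℤ) → Val 𝕏
combine 𝕏 ℤ z̄ ȳ = All.tabulate value
  where
  value : ∀ {X} → X ∈ˢ 𝕏 → Bool
  value {X} X∈𝕏 with X ∈? elements ℤ
  ... | yes X∈ℤ = All.lookup z̄ X∈ℤ
  ... | no  X∉ℤ = All.lookup ȳ (∈∖⁺ 𝕏 ℤ X∈𝕏 X∉ℤ)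

------------------------------------------------------------------------
-- Intersection types

infixr 7 _⊗_
infixr 6 _⊸_
infix  4 _≈ᵖ_ _≈ᵗ_ _≈⨄_

data Ground : Set where
  name : Name → Ground
  _⊗_  : Ground → Ground → Ground

mutual

  -- The finite multiset [A₁,…,Aₙ] is represented by a list; _≈ᵗ_ and _≈ᵖ_
  -- identify lists up to reordering, hereditarily.
  data Pos : Set where
    ground   : Ground → Pos
    multiset : List Type → Pos

  data Type : Set where
    pos : Pos → Type
    _⊸_ : Pos → Type → Type

mutual

  data _≈ᵖ_ : Pos → Pos → Set where
    ground   : ∀ {L} → ground L ≈ᵖ ground L
    multiset : ∀ {As Bs} → Permutation _≈ᵗ_ As Bs → multiset As ≈ᵖ multiset Bs

  data _≈ᵗ_ : Type → Type → Set where
    pos : ∀ {P Q} → P ≈ᵖ Q → pos P ≈ᵗ pos Q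
    _⊸_ : ∀ {P Q A B} → P ≈ᵖ Q → A ≈ᵗ B → (P ⊸ A) ≈ᵗ (Q ⊸ B)

-- Variables are de Bruijn indices.  A context lists the types of the variables
-- in scope; all other variables are mapped to [].
Ctx : ℕ → Set
Ctx = Vec Pos

-- The ground part Λ of a context Λ,Γ.
groundPart : ∀ {n} → Ctx n → Ctx n
groundPart = Vec.map λ where
  (ground L)   → ground L
  (multiset _) → multiset []

-- "The multiset part is empty here."
data NoMultiset : Pos → Set where
  ground : ∀ {L} → NoMultiset (ground L)
  empty  : NoMultiset (multiset [])

Grounded : ∀ {n} → Ctx n → Set
Grounded Θ = ∀ x → NoMultiset (lookup Θ x)

-- Θ ≈⨄ᶜ (Θ₁ ∷ … ∷ Θₖ ∷ []) says that Θ is Λ,Γ₁⊎…⊎Γₖ and each Θᵢ is Λ,Γᵢ, with one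
-- and the same ground part Λ.  For k = 0 it says that Θ has no multiset part.
data _≈⨄_ : Pos → List Pos → Set where
  ground   : ∀ {L Ps} → All (_≡ ground L) Ps → ground L ≈⨄ Ps
  multiset : ∀ {As Ps Ass} → Ps ≡ map multiset Ass → Permutation _≈ᵗ_ As (concat Ass) →
             multiset As ≈⨄ Ps

_≈⨄ᶜ_ : ∀ {n} → Ctx n → List (Ctx n) → Set
Θ ≈⨄ᶜ Θs = ∀ x → lookup Θ x ≈⨄ map (λ Θᵢ → lookup Θᵢ x) Θs

-- The names occurring in a ground type, positive type, type and context, with
-- repetitions.
occᵍ : Ground → List Name
occᵍ (name X) = X ∷ []
occᵍ (K ⊗ L)  = occᵍ K ++ occᵍ L

mutual

  occᵖ : Pos → List Name
  occᵖ (ground L)    = occᵍ L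
  occᵖ (multiset As) = occᵗˢ As

  occᵗ : Type → List Name
  occᵗ (pos P) = occᵖ P
  occᵗ (P ⊸ A) = occᵖ P ++ occᵗ A

  occᵗˢ : List Type → List Name
  occᵗˢ []       = []
  occᵗˢ (A ∷ As) = occᵗ A ++ occᵗˢ As

occᶜ : ∀ {n} → Ctx n → List Name
occᶜ []      = []
occᶜ (P ∷ Θ) = occᵖ P ++ occᶜ Θ

------------------------------------------------------------------------
-- Terms, derivations, factors

-- Only the commutative semiring structure of ℝ≥0 is used from here on; at the
-- end of the file the module is opened with ℝ≥0 itself.
module Calculus (ℛ : CommutativeSemiring 0ℓ 0ℓ) where

  open CommutativeSemiring ℛ using (Carrier; _≈_; _+_; _*_; 1#)

  record Dist : Set where
    field
      prob  : Bool → Carrier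
      total : prob true + prob false ≈ 1#
  open Dist public

  -- Term n and Value n: de Bruijn terms with n variables in scope.
  mutual

    data Term (n : ℕ) : Set where
      val    : Value n → Term n
      sample : Dist → Term n
      case   : Value n → List (Value n × Dist) → Term n
      obs    : Fin n → Bool → Term n
      let′   : Term n → Term (suc n) → Term n
      letp   : Value n → Term (suc (suc n)) → Term n    -- letp ⟨x,y⟩ = v in t: y is 0, x is 1
      app    : Term n → Value n → Term n
      lam    : Term (suc n) → Term n
      der    : Value n → Term n

    data Value (n : ℕ) : Set where
      var  : Fin n → Value n
      pair : Value n → Value n → Value n
      bang : Term n → Value n
      bool : Bool → Value n

  -- ⟨v⟩ = v and ⟨v₁,v₂,…⟩ = ⟨v₁,⟨v₂,…⟩⟩.
  tuple : ∀ {n k} → Vec (Value n) (suc k) → Value n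
  tuple (v ∷ [])     = v
  tuple (v ∷ w ∷ vs) = pair v (tuple (w ∷ vs))

  booleans : ∀ k → List (Vec Bool k)
  booleans zero    = [] ∷ []
  booleans (suc k) = map (true ∷_) (booleans k) ++ map (false ∷_) (booleans k)

  -- c⟨y₁,…,yₖ⟩ for k ≥ 1; the family of branches indexed by {t,f}ᵏ is listed in
  -- the order of booleans.  The yᵢ need not be distinct.
  cond : ∀ {n k} → Vec (Fin n) (suc k) → (Vec Bool (suc k) → Dist) → Term n
  cond {k = k} ys d = case (tuple (Vec.map var ys)) (map (λ b̄ → tuple (Vec.map bool b̄) , d b̄) (booleans (suc k)))

  infix 3 _⊢_∶_

  record Judgment : Set where
    constructor _⊢_∶_
    field
      {scope} : ℕ
      ctx     : Ctx scope
      term    : Term scope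
      type    : Type

  Occ : Judgment → List Name
  Occ (Θ ⊢ _ ∶ A) = occᶜ Θ ++ occᵗ A

  Nm : Judgment → NameSet
  Nm J = ⌈ Occ J ⌉

  -- Since multisets are lists here, a rule in which the same positive type, or
  -- the same multiset part of a context, occurs twice compares the two
  -- occurrences by _≈ᵖ_ and _≈⨄ᶜ_.  A Tree is a derivation without the naming
  -- condition, which Derivation adds.
  data Tree : Judgment → Set where

    i-sample : ∀ {n} {Θ : Ctx n} d X → Grounded Θ → X ∉ occᶜ Θ →
               Tree (Θ ⊢ sample d ∶ pos (ground (name X)))

    i-cond   : ∀ {n k} {Θ : Ctx n} (ys : Vec (Fin n) (suc k)) (Ys : Vec Name (suc k)) d X →
               Grounded Θ → (∀ i → lookup Θ (lookup ys i) ≡ ground (name (lookup Ys i))) →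
               X ∉ toList Ys → X ∉ occᶜ Θ →
               Tree (Θ ⊢ cond ys d ∶ pos (ground (name X)))

    i-var    : ∀ {n} {Θ : Ctx n} {P} x → (∀ y → y ≢ x → NoMultiset (lookup Θ y)) → lookup Θ x ≈ᵖ P →
               Tree (Θ ⊢ val (var x) ∶ pos P)

    i-let    : ∀ {n} {Θ Θ₁ Θ₂ : Ctx n} {u t P P′ A} →
               Tree (Θ₁ ⊢ u ∶ pos P) → Tree (P′ ∷ Θ₂ ⊢ t ∶ A) → P ≈ᵖ P′ → Θ ≈⨄ᶜ (Θ₁ ∷ Θ₂ ∷ []) →
               Tree (Θ ⊢ let′ u t ∶ A)

    i-pair   : ∀ {n} {Θ : Ctx n} {v w L₁ L₂} → Grounded Θ →
               Tree (Θ ⊢ val v ∶ pos (ground L₁)) → Tree (Θ ⊢ val w ∶ pos (ground L₂)) →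
               Tree (Θ ⊢ val (pair v w) ∶ pos (ground (L₁ ⊗ L₂)))

    i-letp   : ∀ {n} {Θ : Ctx n} {v t L₁ L₂ A} →
               Tree (groundPart Θ ⊢ val v ∶ pos (ground (L₁ ⊗ L₂))) →
               Tree (ground L₂ ∷ ground L₁ ∷ Θ ⊢ t ∶ A) →
               Tree (Θ ⊢ letp v t ∶ A)

    i-abs    : ∀ {n} {Θ : Ctx n} {t P A} →
               Tree (P ∷ Θ ⊢ t ∶ A) →
               Tree (Θ ⊢ lam t ∶ (P ⊸ A))

    i-app    : ∀ {n} {Θ Θ₁ Θ₂ : Ctx n} {t v P P′ A} →
               Tree (Θ₁ ⊢ t ∶ (P ⊸ A)) → Tree (Θ₂ ⊢ val v ∶ pos P′) → P ≈ᵖ P′ → Θ ≈⨄ᶜ (Θ₁ ∷ Θ₂ ∷ []) →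
               Tree (Θ ⊢ app t v ∶ A)

    i-bang   : ∀ {n} {Θ : Ctx n} {Θs t As} →
               Pointwise (λ Θᵢ Aᵢ → Tree (Θᵢ ⊢ t ∶ Aᵢ)) Θs As → Θ ≈⨄ᶜ Θs →
               Tree (Θ ⊢ val (bang t) ∶ pos (multiset As))

    i-der    : ∀ {n} {Θ : Ctx n} {v A} →
               Tree (Θ ⊢ val v ∶ pos (multiset (A ∷ []))) →
               Tree (Θ ⊢ der v ∶ A)

  Trees : ∀ {n} → Term n → List (Ctx n) → List Type → Set
  Trees t = Pointwise (λ Θ A → Tree (Θ ⊢ t ∶ A))

  -- A probabilistic axiom, reduced to the data that determine its main name
  -- and its factor: condᵃ Ys d X stands for an (i-cond) axiom with yᵢ : Yᵢ.
  data ProbAxiom : Set where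
    sampleᵃ : Dist → Name → ProbAxiom
    condᵃ   : ∀ {k} → Vec Name (suc k) → (Vec Bool (suc k) → Dist) → Name → ProbAxiom

  mainName : ProbAxiom → Name
  mainName (sampleᵃ _ X) = X
  mainName (condᵃ _ _ X) = X

  mutual

    axioms : ∀ {J} → Tree J → List ProbAxiom
    axioms (i-sample d X _ _)      = sampleᵃ d X ∷ []
    axioms (i-cond _ Ys d X _ _ _ _) = condᵃ Ys d X ∷ []
    axioms (i-var _ _ _)           = []
    axioms (i-let π₁ π₂ _ _)       = axioms π₁ ++ axioms π₂
    axioms (i-pair _ π₁ π₂)        = axioms π₁ ++ axioms π₂
    axioms (i-letp π₁ π₂)          = axioms π₁ ++ axioms π₂
    axioms (i-abs π₁)              = axioms π₁
    axioms (i-app π₁ π₂ _ _)       = axioms π₁ ++ axioms π₂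
    axioms (i-bang πs _)           = axiomsˢ πs
    axioms (i-der π₁)              = axioms π₁

    axiomsˢ : ∀ {n} {t : Term n} {Θs As} → Trees t Θs As → List ProbAxiom
    axiomsˢ []       = []
    axiomsˢ (π ∷ πs) = axioms π ++ axiomsˢ πs

  mutual

    OccTree : ∀ {J} → Tree J → List Name
    OccTree {J} π = Occ J ++ OccPremises π

    OccPremises : ∀ {J} → Tree J → List Name
    OccPremises (i-sample _ _ _ _)       = []
    OccPremises (i-cond _ _ _ _ _ _ _ _) = []
    OccPremises (i-var _ _ _)            = []
    OccPremises (i-let π₁ π₂ _ _)        = OccTree π₁ ++ OccTree π₂
    OccPremises (i-pair _ π₁ π₂)         = OccTree π₁ ++ OccTree π₂
    OccPremises (i-letp π₁ π₂)           = OccTree π₁ ++ OccTree π₂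
    OccPremises (i-abs π₁)               = OccTree π₁
    OccPremises (i-app π₁ π₂ _ _)        = OccTree π₁ ++ OccTree π₂
    OccPremises (i-bang πs _)            = OccTrees πs
    OccPremises (i-der π₁)               = OccTree π₁

    OccTrees : ∀ {n} {t : Term n} {Θs As} → Trees t Θs As → List Name
    OccTrees []       = []
    OccTrees (π ∷ πs) = OccTree π ++ OccTrees πs

  DistinctMainNames : List ProbAxiom → Set
  DistinctMainNames axs = Unique (map mainName axs)

  record Derivation (J : Judgment) : Set where
    constructor _,!_
    field
      tree   : Tree J
      naming : DistinctMainNames (axioms tree)
  open Derivation public

  Nmᵈ : ∀ {J} → Derivation J → NameSet
  Nmᵈ π = ⌈ OccTree (tree π) ⌉

  distinct-++⁻ : ∀ axs {axs′} → DistinctMainNames (axs ++ axs′) → DistinctMainNames axs × DistinctMainNames axs′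
  distinct-++⁻ []         d       = [] , d
  distinct-++⁻ (ax ∷ axs) {axs′} (p ∷ d) =
    All.++⁻ˡ _ (subst (All _) (map-++ mainName axs axs′) p) ∷ proj₁ (distinct-++⁻ axs d) , proj₂ (distinct-++⁻ axs d)

  SomeDerivation : Set
  SomeDerivation = ∃ Derivation

  private

    two : ∀ {J₁ J₂} (π₁ : Tree J₁) (π₂ : Tree J₂) → DistinctMainNames (axioms π₁ ++ axioms π₂) →
          List SomeDerivation
    two π₁ π₂ d = (_ , π₁ ,! proj₁ (distinct-++⁻ (axioms π₁) d))
                ∷ (_ , π₂ ,! proj₂ (distinct-++⁻ (axioms π₁) d)) ∷ []

    many : ∀ {n} {t : Term n} {Θs As} (πs : Trees t Θs As) → DistinctMainNames (axiomsˢ πs) →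
           List SomeDerivation
    many []       _ = []
    many (π ∷ πs) d = (_ , π ,! proj₁ (distinct-++⁻ (axioms π) d))
                    ∷ many πs (proj₂ (distinct-++⁻ (axioms π) d))

  -- The derivations π₁,…,πₙ of the premises of the last rule.
  premises : ∀ {J} → Derivation J → List SomeDerivation
  premises (i-sample _ _ _ _ ,! _)       = []
  premises (i-cond _ _ _ _ _ _ _ _ ,! _) = []
  premises (i-var _ _ _ ,! _)            = []
  premises (i-let π₁ π₂ _ _ ,! d)        = two π₁ π₂ d
  premises (i-pair _ π₁ π₂ ,! d)         = two π₁ π₂ d
  premises (i-letp π₁ π₂ ,! d)           = two π₁ π₂ d
  premises (i-abs π₁ ,! d)               = (_ , π₁ ,! d) ∷ []
  premises (i-app π₁ π₂ _ _ ,! d)        = two π₁ π₂ d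
  premises (i-bang πs _ ,! d)            = many πs d
  premises (i-der π₁ ,! d)               = (_ , π₁ ,! d) ∷ []

  Compatible : List SomeDerivation → Set
  Compatible πs = ∀ Z j →
    Z ∈ˢ Nmᵈ (proj₂ (List.lookup πs j)) → Z ∉ˢ Nm (proj₁ (List.lookup πs j)) →
    ∀ i → i ≢ j → Z ∉ˢ Nmᵈ (proj₂ (List.lookup πs i))

  record Factor : Set where
    field
      names : NameSet
      value : Val names → Carrier
  open Factor public

  infix 4 _≋_

  -- Equality of factors: the same set of names, and the same function once
  -- valuations are transported along that equality of sets.
  record _≋_ (φ ψ : Factor) : Set where
    field
      names-⊆ : names φ ⊆ names ψ
      names-⊇ : names ψ ⊆ names φ
      value-≈ : ∀ x̄ → value φ x̄ ≈ value ψ (x̄ ↾ names-⊇)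

  infixr 7 _⊙_

  _⊙_ : Factor → Factor → Factor
  φ₁ ⊙ φ₂ = record
    { names = names φ₁ ∪ names φ₂
    ; value = λ z̄ → value φ₁ (z̄ ↾ ⊆-∪ˡ (names φ₁) (names φ₂)) * value φ₂ (z̄ ↾ ⊆-∪ʳ (names φ₁) (names φ₂))
    }

  𝟙 : Factor
  𝟙 = record { names = ⌈ [] ⌉ ; value = const 1# }

  ⨀ : List Factor → Factor
  ⨀ = foldr _⊙_ 𝟙

  sumOver : (Xs : List Name) → (Valᴸ Xs → Carrier) → Carrier
  sumOver []       f = f []
  sumOver (X ∷ Xs) f = sumOver Xs (λ z̄ → f (true ∷ z̄)) + sumOver Xs (λ z̄ → f (false ∷ z̄))

  ∑ : ∀ ℤ φ → ℤ ⊆ names φ → Factor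
  ∑ ℤ φ _ = record
    { names = names φ ∖ ℤ
    ; value = λ ȳ → sumOver (elements ℤ) (λ z̄ → value φ (combine (names φ) ℤ z̄ ȳ))
    }

  ⋃-names-⊆-⨀ : ∀ φs → ⋃ (map names φs) ⊆ names (⨀ φs)
  ⋃-names-⊆-⨀ φs {X} = subst (X ∈ˢ_) (⋃-names φs)
    where
    ⋃-names : ∀ φs → ⋃ (map names φs) ≡ names (⨀ φs)
    ⋃-names []       = refl
    ⋃-names (φ ∷ φs) = cong (names φ ∪_) (⋃-names φs)

  ⋃-names-∖-⊆-⨀ : ∀ φs 𝕐 → ⋃ (map names φs) ∖ 𝕐 ⊆ names (⨀ φs)
  ⋃-names-∖-⊆-⨀ φs 𝕐 = ⋃-names-⊆-⨀ φs ∘ ∖-⊆ (⋃ (map names φs)) 𝕐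

  factor : ProbAxiom → Factor
  factor (sampleᵃ d X) = record
    { names = ⌈ X ∷ [] ⌉
    ; value = λ x̄ → prob d (All.lookup x̄ (∈⌈⌉⁺ (X ∷ []) (here refl)))
    }
  factor (condᵃ Ys d X) = record
    { names = 𝕐 ∪ ⌈ X ∷ [] ⌉
    ; value = λ z̄ → prob (d (tabulate λ i → All.lookup z̄ (Y∈ i))) (All.lookup z̄ X∈)
    }
    where
    𝕐 = ⌈ toList Ys ⌉
    Y∈ : ∀ i → lookup Ys i ∈ˢ 𝕐 ∪ ⌈ X ∷ [] ⌉
    Y∈ i = ⊆-∪ˡ 𝕐 ⌈ X ∷ [] ⌉ (∈⌈⌉⁺ (toList Ys) (∈-toList⁺ (∈-lookup i Ys)))
    X∈ : X ∈ˢ 𝕐 ∪ ⌈ X ∷ [] ⌉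
    X∈ = ⊆-∪ʳ 𝕐 ⌈ X ∷ [] ⌉ (∈⌈⌉⁺ (X ∷ []) (here refl))

  Cpts : ∀ {J} → Derivation J → List Factor
  Cpts π = map factor (axioms (tree π))

  ⟦_⟧ : ∀ {J} → Derivation J → Factor
  ⟦_⟧ {J} π = ∑ (⋃ (map names (Cpts π)) ∖ Nm J) (⨀ (Cpts π)) (⋃-names-∖-⊆-⨀ (Cpts π) (Nm J))

  ⟦_⟧ˢ : List SomeDerivation → List Factor
  ⟦ πs ⟧ˢ = map (λ π → ⟦ proj₂ π ⟧) πs

open Calculus ℝ≥0 public

{-# OPTIONS --safe #-}
module Submission where

-- A name of a premise that is not visible in the conclusion of that premise
-- (a private name) is, by compatibility, foreign to the other premises, so its
-- sum commutes with the product over the premises.  Hence the right-hand side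
-- sums the product of all axiom factors first over the private names and then
-- over the remaining names outside J.  Every name of J occurs in the conclusion
-- of some premise, and by compatibility it is then private in no premise;
-- therefore the names summed out on the two sides are the same.

open import Defs hiding
  ( Factor; names; value; _≋_; _⊙_; 𝟙; ⨀; sumOver; ∑; ⋃-names-∖-⊆-⨀ )
open import Algebra.Bundles using (CommutativeSemiring)
open import Data.Bool.Base using (Bool; true; false)
open import Data.Empty using (⊥-elim)
open import Data.List.Base using (List; []; _∷_; _++_; concat; concatMap; foldr; length; map)
import Data.Nat.Base as ℕ
import Data.Nat.Properties as ℕ
open import Data.List.Membership.DecPropositional ℕ._≟_ using (_∈?_)
open import Data.List.Membership.Propositional using (_∈_; _∉_; find; lose)
open import Data.List.Membership.Propositional.Properties
  using (∈-++⁺ˡ; ∈-++⁺ʳ; ∈-++⁻; ∈-filter⁻; ∈-deduplicate⁻; ∈-concatMap⁺; ∈-concatMap⁻; ∈-AllPairs₂)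
open import Data.List.Membership.Propositional.Properties.WithK using (unique∧set⇒bag)
open import Data.Fin.Base using (zero; suc)
open import Data.List.Properties
  using (foldr-++; ++-assoc; ++-identityʳ; concatMap-map; length-map; map-concatMap; tabulate-lookup)
open import Data.List.Relation.Binary.BagAndSetEquality using (∼bag⇒↭)
open import Data.List.Relation.Binary.Disjoint.Propositional using (Disjoint)
open import Data.List.Relation.Binary.Permutation.Propositional as Perm using (_↭_)
open import Data.List.Relation.Binary.Permutation.Homogeneous as Permutation using (Permutation)
open import Data.List.Relation.Binary.Pointwise.Base using (Pointwise; []; _∷_)
open import Data.List.Relation.Unary.All as All using ([]; _∷_)
import Data.List.Relation.Unary.All.Properties as All
open import Data.List.Relation.Unary.AllPairs as AllPairs using (AllPairs; []; _∷_)
import Data.List.Relation.Unary.AllPairs.Properties as AllPairs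
open import Data.List.Relation.Unary.Any as Any using (Any; here; there)
import Data.List.Relation.Unary.Any.Properties as Any
open import Data.List.Relation.Unary.Unique.Propositional using (Unique)
import Data.List.Relation.Unary.Unique.Propositional.Properties as Unique
open import Data.Nat.Base using (_≤_; z≤n; s≤s)
open import Data.Product.Base using (∃; _×_; _,_; proj₁; proj₂)
open import Data.Sum.Base using (inj₁; inj₂)
open import Data.Vec.Base using ([]; _∷_; lookup; toList)
open import Data.Vec.Membership.Propositional.Properties using (∈-toList⁻)
import Data.Vec.Relation.Unary.Any as VecAny
import Data.Vec.Relation.Unary.Any.Properties as VecAny
open import Function.Base using (_∘_; const; case_of_)
open import Function.Bundles using (mk⇔)
open import Level using (0ℓ)
open import Relation.Binary.PropositionalEquality.Core
  using (_≡_; _≢_; refl; sym; trans; cong; cong₂; subst)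
open import Relation.Binary.PropositionalEquality using (module ≡-Reasoning)
open import Relation.Nullary using (yes; no; ¬?)
open import Relation.Nullary.Decidable using (decidable-stable)

-- Total assignments of booleans to names

-- Valuations are handled as restrictions of total assignments of booleans to
-- names, which avoids transport along equalities of name sets.

Assignment : Set
Assignment = Name → Bool

infixl 20 _[_≔_]

_[_≔_] : Assignment → Name → Bool → Assignment
(ρ [ X ≔ b ]) Y with Y ℕ.≟ X
... | yes _ = b
... | no  _ = ρ Y

AgreeOn : List Name → Assignment → Assignment → Set
AgreeOn Xs ρ σ = ∀ {X} → X ∈ Xs → ρ X ≡ σ X

≔-same : ∀ ρ X b → (ρ [ X ≔ b ]) X ≡ b
≔-same ρ X b with X ℕ.≟ X
... | yes _   = refl
... | no  X≢X = ⊥-elim (X≢X refl)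

≔-other : ∀ ρ {X Y} b → Y ≢ X → (ρ [ X ≔ b ]) Y ≡ ρ Y
≔-other ρ {X} {Y} b Y≢X with Y ℕ.≟ X
... | yes Y≡X = ⊥-elim (Y≢X Y≡X)
... | no  _   = refl

≔-agree : ∀ {ρ σ Xs} X b → AgreeOn Xs ρ σ → AgreeOn Xs (ρ [ X ≔ b ]) (σ [ X ≔ b ])
≔-agree X b ρ≗σ {Y} Y∈Xs with Y ℕ.≟ X
... | yes _ = refl
... | no  _ = ρ≗σ Y∈Xs

≔-fresh : ∀ {ρ X Xs} b → X ∉ Xs → AgreeOn Xs (ρ [ X ≔ b ]) ρ
≔-fresh {ρ} b X∉Xs Y∈Xs = ≔-other ρ b λ { refl → X∉Xs Y∈Xs }

≔-comm : ∀ {ρ X Y} b c → X ≢ Y → ∀ Z → (ρ [ X ≔ b ] [ Y ≔ c ]) Z ≡ (ρ [ Y ≔ c ] [ X ≔ b ]) Z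
≔-comm {ρ} {X} {Y} b c X≢Y Z with Z ℕ.≟ Y
≔-comm {ρ} {X} {Y} b c X≢Y Z | yes refl with Y ℕ.≟ X
... | yes Y≡X = ⊥-elim (X≢Y (sym Y≡X))
... | no  _   = sym (≔-same ρ Y c)
≔-comm {ρ} {X} {Y} b c X≢Y Z | no Z≢Y with Z ℕ.≟ X
... | yes _ = refl
... | no  _ = sym (≔-other ρ c Z≢Y)

override : Assignment → ∀ {Zs} → Valᴸ Zs → Assignment
override ρ []                 = ρ
override ρ (_∷_ {x = Z} b z̄) = override (ρ [ Z ≔ b ]) z̄

override-∉ : ∀ {Zs} ρ (z̄ : Valᴸ Zs) {X} → X ∉ Zs → override ρ z̄ X ≡ ρ X
override-∉ ρ []      X∉Zs = refl
override-∉ ρ (b ∷ z̄) X∉Zs =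
  trans (override-∉ _ z̄ (X∉Zs ∘ there)) (≔-other ρ b (X∉Zs ∘ here))

-- Later entries overwrite earlier ones, so an entry is read back only if its name is not repeated
-- further on.
override-∈ : ∀ {Zs} ρ (z̄ : Valᴸ Zs) {X} → Unique Zs → (X∈Zs : X ∈ Zs) → override ρ z̄ X ≡ All.lookup z̄ X∈Zs
override-∈ ρ (b ∷ z̄) {X} (Z≢ ∷ _) (here refl) =
  trans (override-∉ _ z̄ (λ X∈Zs → All.lookup Z≢ X∈Zs refl)) (≔-same ρ X b)
override-∈ ρ (b ∷ z̄) (_ ∷ Zs!) (there X∈Zs) = override-∈ _ z̄ Zs! X∈Zs

restrict : Assignment → ∀ Xs → Valᴸ Xs
restrict ρ Xs = All.tabulate λ {X} _ → ρ X

-- Stated for an `x̄` that equals a tabulation, so that `f` is found by unification even when it is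
-- local to a definition, as in `combine`.
lookup-tabulate : ∀ {Xs} {x̄ : Valᴸ Xs} {f : ∀ {X} → X ∈ Xs → Bool} → x̄ ≡ All.tabulate f →
                  ∀ {X} (X∈Xs : X ∈ Xs) → All.lookup x̄ X∈Xs ≡ f X∈Xs
lookup-tabulate refl (here refl)  = refl
lookup-tabulate refl (there X∈Xs) = lookup-tabulate refl X∈Xs

lookup-restrict : ∀ ρ {Xs X} (X∈Xs : X ∈ Xs) → All.lookup (restrict ρ Xs) X∈Xs ≡ ρ X
lookup-restrict ρ = lookup-tabulate refl

lookup≡⇒≡restrict : ∀ {Xs} (x̄ : Valᴸ Xs) ρ → (∀ {X} (X∈Xs : X ∈ Xs) → All.lookup x̄ X∈Xs ≡ ρ X) →
                    x̄ ≡ restrict ρ Xs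
lookup≡⇒≡restrict []      ρ eq = refl
lookup≡⇒≡restrict (b ∷ x̄) ρ eq = cong₂ _∷_ (eq (here refl)) (lookup≡⇒≡restrict x̄ ρ (eq ∘ there))

-- Every valuation thus comes from an assignment, so an identity between factors may be tested on
-- assignments alone.
restrict-override : ∀ 𝕏 (x̄ : Val 𝕏) ρ → x̄ ≡ restrict (override ρ x̄) (elements 𝕏)
restrict-override 𝕏 x̄ ρ = lookup≡⇒≡restrict x̄ _ λ X∈𝕏 → sym (override-∈ ρ x̄ (unique 𝕏) X∈𝕏)

restrict-↾ : ∀ ρ {Xs Ys} (Ys⊆Xs : ∀ {X} → X ∈ Ys → X ∈ Xs) → restrict ρ Xs ↾ Ys⊆Xs ≡ restrict ρ Ys
restrict-↾ ρ Ys⊆Xs = lookup≡⇒≡restrict _ ρ λ Y∈Ys → trans (lookup-tabulate refl Y∈Ys) (lookup-restrict ρ (Ys⊆Xs Y∈Ys))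

restrict-cong : ∀ {ρ σ Xs} → AgreeOn Xs ρ σ → restrict ρ Xs ≡ restrict σ Xs
restrict-cong {ρ} {σ} ρ≗σ = lookup≡⇒≡restrict _ σ λ X∈Xs → trans (lookup-restrict ρ X∈Xs) (ρ≗σ X∈Xs)

combine-restrict : ∀ 𝕏 ℤ (z̄ : Val ℤ) ρ →
                   combine 𝕏 ℤ z̄ (restrict ρ (elements (𝕏 ∖ ℤ))) ≡ restrict (override ρ z̄) (elements 𝕏)
combine-restrict 𝕏 ℤ z̄ ρ = lookup≡⇒≡restrict _ _ step
  where
  step : ∀ {X} (X∈𝕏 : X ∈ˢ 𝕏) →
         All.lookup (combine 𝕏 ℤ z̄ (restrict ρ (elements (𝕏 ∖ ℤ)))) X∈𝕏 ≡ override ρ z̄ X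
  step {X} X∈𝕏
    -- The lookup equation is abstracted together with the decision, so that the branching inside
    -- `combine` reduces in its type.
    with X ∈? elements ℤ
       | lookup-tabulate {x̄ = combine 𝕏 ℤ z̄ (restrict ρ (elements (𝕏 ∖ ℤ)))} refl X∈𝕏
  ... | yes X∈ℤ | eq = trans eq (sym (override-∈ ρ z̄ (unique ℤ) X∈ℤ))
  ... | no  X∉ℤ | eq = trans eq (trans (lookup-restrict ρ (∈∖⁺ 𝕏 ℤ X∈𝕏 X∉ℤ)) (sym (override-∉ ρ z̄ X∉ℤ)))

-- Membership in finite sets of names

∈∖⁻ : ∀ 𝕏 𝕐 {X} → X ∈ˢ 𝕏 ∖ 𝕐 → X ∈ˢ 𝕏 × X ∉ˢ 𝕐
∈∖⁻ 𝕏 𝕐 = ∈-filter⁻ (λ X → ¬? (X ∈? elements 𝕐))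

∈⌈⌉⁻ : ∀ Xs {X} → X ∈ˢ ⌈ Xs ⌉ → X ∈ Xs
∈⌈⌉⁻ = ∈-deduplicate⁻ ℕ._≟_

∈⋃-map⁺ : ∀ {A : Set} (f : A → NameSet) {as X} → Any (λ a → X ∈ˢ f a) as → X ∈ˢ ⋃ (map f as)
∈⋃-map⁺ f {a ∷ as} (here X∈a)  = ⊆-∪ˡ (f a) (⋃ (map f as)) X∈a
∈⋃-map⁺ f {a ∷ as} (there X∈as) = ⊆-∪ʳ (f a) (⋃ (map f as)) (∈⋃-map⁺ f X∈as)

∈⋃-map⁻ : ∀ {A : Set} (f : A → NameSet) as {X} → X ∈ˢ ⋃ (map f as) → Any (λ a → X ∈ˢ f a) as
∈⋃-map⁻ f (a ∷ as) X∈ with ∈-++⁻ (elements (f a)) (∈⌈⌉⁻ (elements (f a) ++ elements (⋃ (map f as))) X∈)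
... | inj₁ X∈a  = here X∈a
... | inj₂ X∈as = there (∈⋃-map⁻ f as X∈as)

-- Without repetitions, equal members mean equal multiplicities, and lists with equal multiplicities
-- are permutations of each other.
unique⇒↭ : ∀ {Xs Ys : List Name} → Unique Xs → Unique Ys →
           (∀ {X} → X ∈ Xs → X ∈ Ys) → (∀ {X} → X ∈ Ys → X ∈ Xs) → Xs ↭ Ys
unique⇒↭ Xs! Ys! Xs⊆Ys Ys⊆Xs = ∼bag⇒↭ (unique∧set⇒bag Xs! Ys! (mk⇔ Xs⊆Ys Ys⊆Xs))

-- Marginalisation of functions of assignments

-- For an abstract semiring _≈_ does not unfold to the relation between Cauchy
-- sequences, so its arguments can be inferred.
module Factorisation (ℛ : CommutativeSemiring 0ℓ 0ℓ) where

  open Calculus ℛ using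
    ( Factor; names; value; _≋_; _⊙_; 𝟙; ⨀; sumOver; ∑; ⋃-names-∖-⊆-⨀ )
  open CommutativeSemiring ℛ hiding (refl; sym; trans)
  module ≈ = CommutativeSemiring ℛ using (refl; sym; trans)
  open import Algebra.Properties.CommutativeSemigroup +-commutativeSemigroup using (interchange)
  open import Relation.Binary.Reasoning.Setoid setoid

  -- Besides bounding the support of `F`, this lets pointwise equal assignments be exchanged under
  -- `F` without function extensionality.
  _DependsOn_ : (Assignment → Carrier) → List Name → Set
  F DependsOn Xs = ∀ {ρ σ} → AgreeOn Xs ρ σ → F ρ ≈ F σ

  marg : Name → (Assignment → Carrier) → Assignment → Carrier
  marg X F ρ = F (ρ [ X ≔ true ]) + F (ρ [ X ≔ false ])

  margs : List Name → (Assignment → Carrier) → Assignment → Carrier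
  margs Xs F = foldr marg F Xs

  margs-cong : ∀ Xs {F G} → (∀ ρ → F ρ ≈ G ρ) → ∀ ρ → margs Xs F ρ ≈ margs Xs G ρ
  margs-cong []       F≈G ρ = F≈G ρ
  margs-cong (X ∷ Xs) F≈G ρ = +-cong (margs-cong Xs F≈G _) (margs-cong Xs F≈G _)

  margs-dependsOn : ∀ Zs {F Xs} → F DependsOn Xs → margs Zs F DependsOn Xs
  margs-dependsOn []       dep ρ≗σ = dep ρ≗σ
  margs-dependsOn (Z ∷ Zs) dep ρ≗σ =
    +-cong (margs-dependsOn Zs dep (≔-agree Z true ρ≗σ)) (margs-dependsOn Zs dep (≔-agree Z false ρ≗σ))

  -- Updates at distinct names commute pointwise, and `dep` turns this into equality of the values
  -- of `F`; what remains is to rearrange four summands.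
  marg-comm : ∀ X Y {F Xs} → F DependsOn Xs → ∀ ρ → marg X (marg Y F) ρ ≈ marg Y (marg X F) ρ
  marg-comm X Y {F} dep ρ with X ℕ.≟ Y
  ... | yes refl = ≈.refl
  ... | no  X≢Y  = begin
    (F _ + F _) + (F _ + F _) ≈⟨ interchange _ _ _ _ ⟩
    (F _ + F _) + (F _ + F _) ≈⟨ +-cong (+-cong (swap true true) (swap false true))
                                        (+-cong (swap true false) (swap false false)) ⟩
    (F _ + F _) + (F _ + F _) ∎
    where
    swap : ∀ b c → F (ρ [ X ≔ b ] [ Y ≔ c ]) ≈ F (ρ [ Y ≔ c ] [ X ≔ b ])
    swap b c = dep λ {Z} _ → ≔-comm b c X≢Y Z

  -- The order of summation is immaterial, so the listing of one set of names can later be traded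
  -- for a concatenation of several.
  margs-↭ : ∀ {Xs Ys F Zs} → F DependsOn Zs → Xs ↭ Ys → ∀ ρ → margs Xs F ρ ≈ margs Ys F ρ
  margs-↭ dep Perm.refl          ρ = ≈.refl
  margs-↭ dep (Perm.prep X p)    ρ = +-cong (margs-↭ dep p _) (margs-↭ dep p _)
  margs-↭ {X ∷ Y ∷ Xs} {_ ∷ _ ∷ Ys} {F} dep (Perm.swap X Y p) ρ = begin
    marg X (marg Y (margs Xs F)) ρ ≈⟨ marg-comm X Y (margs-dependsOn Xs dep) ρ ⟩
    marg Y (marg X (margs Xs F)) ρ ≈⟨ margs-cong (Y ∷ X ∷ []) (margs-↭ dep p) ρ ⟩
    marg Y (marg X (margs Ys F)) ρ ∎
  margs-↭ dep (Perm.trans p q)   ρ = ≈.trans (margs-↭ dep p ρ) (margs-↭ dep q ρ)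

  -- Updates at `Zs` leave `F` unchanged, so distributivity pulls it out of each sum.
  margs-*ˡ : ∀ Zs {F G Xs} → F DependsOn Xs → Disjoint Zs Xs →
             ∀ ρ → margs Zs (λ σ → F σ * G σ) ρ ≈ F ρ * margs Zs G ρ
  margs-*ˡ []       dep Zs∥Xs ρ = ≈.refl
  margs-*ˡ (Z ∷ Zs) {F} {G} {Xs} dep Zs∥Xs ρ = begin
    margs Zs (λ σ → F σ * G σ) (ρ [ Z ≔ true ]) + margs Zs (λ σ → F σ * G σ) (ρ [ Z ≔ false ])
      ≈⟨ +-cong (branch true) (branch false) ⟩
    F ρ * margs Zs G (ρ [ Z ≔ true ]) + F ρ * margs Zs G (ρ [ Z ≔ false ])
      ≈⟨ distribˡ _ _ _ ⟨
    F ρ * (margs Zs G (ρ [ Z ≔ true ]) + margs Zs G (ρ [ Z ≔ false ])) ∎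
    where
    branch : ∀ b → margs Zs (λ σ → F σ * G σ) (ρ [ Z ≔ b ]) ≈ F ρ * margs Zs G (ρ [ Z ≔ b ])
    branch b = ≈.trans (margs-*ˡ Zs dep (λ (Y∈Zs , Y∈Xs) → Zs∥Xs (there Y∈Zs , Y∈Xs)) _)
                       (*-congʳ (dep (≔-fresh b λ Z∈Xs → Zs∥Xs (here refl , Z∈Xs))))

  -- First `F` leaves the inner sum over `Ws`; then the sum of `G` over `Ws`, which still depends on
  -- `Ys` only, leaves the outer sum over `Zs`.
  margs-* : ∀ Zs Ws {F G Xs Ys} → F DependsOn Xs → G DependsOn Ys → Disjoint Ws Xs → Disjoint Zs Ys →
            ∀ ρ → margs (Zs ++ Ws) (λ σ → F σ * G σ) ρ ≈ margs Zs F ρ * margs Ws G ρ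
  margs-* Zs Ws {F} {G} depF depG Ws∥Xs Zs∥Ys ρ = begin
    margs (Zs ++ Ws) (λ σ → F σ * G σ) ρ
      ≡⟨ cong (λ H → H ρ) (foldr-++ marg (λ σ → F σ * G σ) Zs Ws) ⟩
    margs Zs (margs Ws (λ σ → F σ * G σ)) ρ
      ≈⟨ margs-cong Zs (λ σ → ≈.trans (margs-*ˡ Ws depF Ws∥Xs σ) (*-comm _ _)) ρ ⟩
    margs Zs (λ σ → margs Ws G σ * F σ) ρ
      ≈⟨ margs-*ˡ Zs (margs-dependsOn Ws depG) Zs∥Ys ρ ⟩
    margs Ws G ρ * margs Zs F ρ
      ≈⟨ *-comm _ _ ⟩
    margs Zs F ρ * margs Ws G ρ ∎

  -- Factors as functions of assignments

  sumOver-override : ∀ Zs F ρ → sumOver Zs (λ z̄ → F (override ρ z̄)) ≡ margs Zs F ρ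
  sumOver-override []       F ρ = refl
  sumOver-override (Z ∷ Zs) F ρ = cong₂ _+_ (sumOver-override Zs F _) (sumOver-override Zs F _)

  sumOver-cong : ∀ Xs {f g : Valᴸ Xs → Carrier} → (∀ x̄ → f x̄ ≡ g x̄) → sumOver Xs f ≡ sumOver Xs g
  sumOver-cong []       f≗g = f≗g []
  sumOver-cong (X ∷ Xs) f≗g =
    cong₂ _+_ (sumOver-cong Xs (f≗g ∘ (true ∷_))) (sumOver-cong Xs (f≗g ∘ (false ∷_)))

  -- Gives factors over different sets of names a common domain, on which the product of factors is
  -- the pointwise product.
  eval : Factor → Assignment → Carrier
  eval φ ρ = value φ (restrict ρ (elements (names φ)))

  eval-dependsOn : ∀ φ → eval φ DependsOn elements (names φ)
  eval-dependsOn φ ρ≗σ = reflexive (cong (value φ) (restrict-cong ρ≗σ))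

  eval-⊙ : ∀ φ ψ ρ → eval (φ ⊙ ψ) ρ ≡ eval φ ρ * eval ψ ρ
  eval-⊙ φ ψ ρ = cong₂ _*_ (cong (value φ) (restrict-↾ ρ (⊆-∪ˡ (names φ) (names ψ))))
                           (cong (value ψ) (restrict-↾ ρ (⊆-∪ʳ (names φ) (names ψ))))

  eval-⨀-++ : ∀ φs ψs ρ → eval (⨀ (φs ++ ψs)) ρ ≈ eval (⨀ φs) ρ * eval (⨀ ψs) ρ
  eval-⨀-++ []       ψs ρ = ≈.sym (*-identityˡ _)
  eval-⨀-++ (φ ∷ φs) ψs ρ = begin
    eval (φ ⊙ ⨀ (φs ++ ψs)) ρ                  ≡⟨ eval-⊙ φ (⨀ (φs ++ ψs)) ρ ⟩
    eval φ ρ * eval (⨀ (φs ++ ψs)) ρ           ≈⟨ *-congˡ (eval-⨀-++ φs ψs ρ) ⟩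
    eval φ ρ * (eval (⨀ φs) ρ * eval (⨀ ψs) ρ) ≈⟨ *-assoc _ _ _ ⟨
    eval φ ρ * eval (⨀ φs) ρ * eval (⨀ ψs) ρ   ≡⟨ cong (_* eval (⨀ ψs) ρ) (eval-⊙ φ (⨀ φs) ρ) ⟨
    eval (φ ⊙ ⨀ φs) ρ * eval (⨀ ψs) ρ          ∎

  eval-∑ : ∀ ℤ φ (ℤ⊆φ : ℤ ⊆ names φ) ρ → eval (∑ ℤ φ ℤ⊆φ) ρ ≡ margs (elements ℤ) (eval φ) ρ
  eval-∑ ℤ φ ℤ⊆φ ρ =
    trans (sumOver-cong (elements ℤ) λ z̄ → cong (value φ) (combine-restrict (names φ) ℤ z̄ ρ))
          (sumOver-override (elements ℤ) (eval φ) ρ)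

  eval-≈⇒≋ : ∀ {φ ψ} → names φ ⊆ names ψ → names ψ ⊆ names φ → (∀ ρ → eval φ ρ ≈ eval ψ ρ) → φ ≋ ψ
  eval-≈⇒≋ {φ} {ψ} φ⊆ψ ψ⊆φ eq = record { names-⊆ = φ⊆ψ ; names-⊇ = ψ⊆φ ; value-≈ = value-≈ }
    where
    value-≈ : ∀ x̄ → value φ x̄ ≈ value ψ (x̄ ↾ ψ⊆φ)
    value-≈ x̄ = begin
      value φ x̄          ≡⟨ cong (value φ) x̄≡ ⟩
      eval φ ρ           ≈⟨ eq ρ ⟩
      eval ψ ρ           ≡⟨ cong (value ψ) (trans (cong (_↾ ψ⊆φ) x̄≡) (restrict-↾ ρ ψ⊆φ)) ⟨
      value ψ (x̄ ↾ ψ⊆φ) ∎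
      where
      -- The default `false` is never read: both factors look only at names of `φ`.
      ρ = override (const false) x̄
      x̄≡ : x̄ ≡ restrict ρ (elements (names φ))
      x̄≡ = restrict-override (names φ) x̄ (const false)

  -- Marginals of products of factors

  ⋃-names : ∀ φs → ⋃ (map names φs) ≡ names (⨀ φs)
  ⋃-names []       = refl
  ⋃-names (φ ∷ φs) = cong (names φ ∪_) (⋃-names φs)

  eval-⨀-dependsOn : ∀ φs → eval (⨀ φs) DependsOn elements (⋃ (map names φs))
  eval-⨀-dependsOn φs =
    subst (λ 𝕏 → eval (⨀ φs) DependsOn elements 𝕏) (sym (⋃-names φs)) (eval-dependsOn (⨀ φs))

  -- The common shape of both sides of the theorem: applied to `Cpts π` it is the semantics of `π`,
  -- applied to the semantics of the premises it is the right-hand side.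
  marginal : List Factor → NameSet → Factor
  marginal φs 𝕁 = ∑ (⋃ (map names φs) ∖ 𝕁) (⨀ φs) (⋃-names-∖-⊆-⨀ φs 𝕁)

  ∈-marginal⁺ : ∀ φs 𝕁 {X} → X ∈ˢ ⋃ (map names φs) → X ∈ˢ 𝕁 → X ∈ˢ names (marginal φs 𝕁)
  ∈-marginal⁺ φs 𝕁 {X} X∈φs X∈𝕁 =
    ∈∖⁺ (names (⨀ φs)) (⋃ (map names φs) ∖ 𝕁) (subst (X ∈ˢ_) (⋃-names φs) X∈φs)
        (λ X∈ → proj₂ (∈∖⁻ (⋃ (map names φs)) 𝕁 X∈) X∈𝕁)

  -- Removing what lies outside `𝕁` leaves the intersection with `𝕁`. Membership in `𝕁` comes out
  -- doubly negated and is recovered by decidability.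
  ∈-marginal⁻ : ∀ φs 𝕁 {X} → X ∈ˢ names (marginal φs 𝕁) → X ∈ˢ ⋃ (map names φs) × X ∈ˢ 𝕁
  ∈-marginal⁻ φs 𝕁 {X} X∈ with ∈∖⁻ (names (⨀ φs)) (⋃ (map names φs) ∖ 𝕁) X∈
  ... | X∈⨀ , X∉ =
    X∈φs , decidable-stable (X ∈? elements 𝕁) (λ X∉𝕁 → X∉ (∈∖⁺ (⋃ (map names φs)) 𝕁 X∈φs X∉𝕁))
    where X∈φs = subst (X ∈ˢ_) (sym (⋃-names φs)) X∈⨀

  eval-marginal : ∀ φs 𝕁 ρ →
    eval (marginal φs 𝕁) ρ ≡ margs (elements (⋃ (map names φs) ∖ 𝕁)) (eval (⨀ φs)) ρ
  eval-marginal φs 𝕁 = eval-∑ (⋃ (map names φs) ∖ 𝕁) (⨀ φs) (⋃-names-∖-⊆-⨀ φs 𝕁)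

  -- Families of factors with private names

  module _ {I : Set} (Φ : I → List Factor) (𝕂 : I → NameSet) where

    scope : I → NameSet
    scope i = ⋃ (map names (Φ i))

    private-names : I → List Name
    private-names i = elements (scope i ∖ 𝕂 i)

    -- The part of compatibility that concerns factors, made symmetric so that it can be required of
    -- the unordered pairs of a list.
    Exclusive : I → I → Set
    Exclusive i j = Disjoint (private-names i) (elements (scope j)) × Disjoint (private-names j) (elements (scope i))

    marginals : List I → List Factor
    marginals = map λ i → marginal (Φ i) (𝕂 i)

    ∈-⋃-concatMap⁺ : ∀ {is X} → Any (λ i → X ∈ˢ scope i) is → X ∈ˢ ⋃ (map names (concatMap Φ is))
    ∈-⋃-concatMap⁺ X∈ = ∈⋃-map⁺ names (Any.concatMap⁺ Φ (Any.map (λ {i} → ∈⋃-map⁻ names (Φ i)) X∈))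

    ∈-⋃-concatMap⁻ : ∀ is {X} → X ∈ˢ ⋃ (map names (concatMap Φ is)) → Any (λ i → X ∈ˢ scope i) is
    ∈-⋃-concatMap⁻ is X∈ =
      Any.map (∈⋃-map⁺ names) (Any.concatMap⁻ Φ (∈⋃-map⁻ names (concatMap Φ is) X∈))

    ∈-⋃-marginals⁺ : ∀ {is X} → Any (λ i → X ∈ˢ scope i × X ∈ˢ 𝕂 i) is → X ∈ˢ ⋃ (map names (marginals is))
    ∈-⋃-marginals⁺ X∈ =
      ∈⋃-map⁺ names (Any.map⁺ (Any.map (λ {i} (X∈N , X∈K) → ∈-marginal⁺ (Φ i) (𝕂 i) X∈N X∈K) X∈))

    ∈-⋃-marginals⁻ : ∀ is {X} → X ∈ˢ ⋃ (map names (marginals is)) → Any (λ i → X ∈ˢ scope i × X ∈ˢ 𝕂 i) is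
    ∈-⋃-marginals⁻ is X∈ =
      Any.map (λ {i} → ∈-marginal⁻ (Φ i) (𝕂 i)) (Any.map⁻ (∈⋃-map⁻ names (marginals is) X∈))

    -- Induction on the list: exclusivity makes the private names of the head foreign to the factors
    -- of the tail and conversely, so `margs-*` merges the two sums.
    eval-⨀-marginals : ∀ {is} → AllPairs Exclusive is → ∀ ρ →
      eval (⨀ (marginals is)) ρ ≈ margs (concatMap private-names is) (eval (⨀ (concatMap Φ is))) ρ
    eval-⨀-marginals {[]}     []            ρ = ≈.refl
    eval-⨀-marginals {i ∷ is} (excl ∷ excls) ρ = begin
      eval (marginal (Φ i) (𝕂 i) ⊙ ⨀ (marginals is)) ρ
        ≡⟨ eval-⊙ (marginal (Φ i) (𝕂 i)) (⨀ (marginals is)) ρ ⟩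
      eval (marginal (Φ i) (𝕂 i)) ρ * eval (⨀ (marginals is)) ρ
        ≈⟨ *-cong (reflexive (eval-marginal (Φ i) (𝕂 i) ρ)) (eval-⨀-marginals excls ρ) ⟩
      margs (private-names i) F ρ * margs (concatMap private-names is) G ρ
        ≈⟨ margs-* (private-names i) (concatMap private-names is)
                   (eval-⨀-dependsOn (Φ i)) (eval-⨀-dependsOn (concatMap Φ is)) others∥i i∥others ρ ⟨
      margs (concatMap private-names (i ∷ is)) (λ σ → F σ * G σ) ρ
        ≈⟨ margs-cong (concatMap private-names (i ∷ is)) (λ σ → ≈.sym (eval-⨀-++ (Φ i) (concatMap Φ is) σ)) ρ ⟩
      margs (concatMap private-names (i ∷ is)) (eval (⨀ (concatMap Φ (i ∷ is)))) ρ ∎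
      where
      F = eval (⨀ (Φ i))
      G = eval (⨀ (concatMap Φ is))
      others∥i : Disjoint (concatMap private-names is) (elements (scope i))
      others∥i (X∈is , X∈i) with find (∈-concatMap⁻ private-names {xs = is} X∈is)
      ... | _ , j∈is , X∈j = proj₂ (All.lookup excl j∈is) (X∈j , X∈i)
      i∥others : Disjoint (private-names i) (elements (⋃ (map names (concatMap Φ is))))
      i∥others (X∈i , X∈is) with find (∈-⋃-concatMap⁻ is X∈is)
      ... | _ , j∈is , X∈j = proj₁ (All.lookup excl j∈is) (X∈i , X∈j)

    -- Private names of `j` lie in the scope of `j`, from which the private names of any other
    -- member are absent.
    private-names-! : ∀ {is} → AllPairs Exclusive is → Unique (concatMap private-names is)
    private-names-! {is} excl =
      Unique.concat⁺ (All.map⁺ (All.universal (λ i → unique (scope i ∖ 𝕂 i)) is))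
                     (AllPairs.map⁺ (AllPairs.map disjoint excl))
      where
      disjoint : ∀ {i j} → Exclusive i j → Disjoint (private-names i) (private-names j)
      disjoint {j = j} (i∥j , _) (X∈i , X∈j) = i∥j (X∈i , ∖-⊆ (scope j) (𝕂 j) X∈j)

    -- The names summed out on the left are, without repetition, those summed
    -- out last and those summed out in some factor on the right.
    marginal-marginals : ∀ 𝕁 {is} → AllPairs Exclusive is →
      (∀ {i X} → i ∈ is → X ∈ˢ scope i → X ∈ˢ 𝕁 → X ∈ˢ 𝕂 i) →
      marginal (concatMap Φ is) 𝕁 ≋ marginal (marginals is) 𝕁
    marginal-marginals 𝕁 {is} excl 𝕁-visible = eval-≈⇒≋ left⊆right right⊆left eq
      where
      φs = concatMap Φ is
      Out = elements (⋃ (map names (marginals is)) ∖ 𝕁)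
      In  = concatMap private-names is

      left⊆right : names (marginal φs 𝕁) ⊆ names (marginal (marginals is) 𝕁)
      left⊆right X∈ with ∈-marginal⁻ φs 𝕁 X∈
      ... | X∈φs , X∈𝕁 with find (∈-⋃-concatMap⁻ is X∈φs)
      ...   | i , i∈is , X∈i =
        ∈-marginal⁺ (marginals is) 𝕁 (∈-⋃-marginals⁺ (lose i∈is (X∈i , 𝕁-visible i∈is X∈i X∈𝕁))) X∈𝕁

      marginals⊆φs : ⋃ (map names (marginals is)) ⊆ ⋃ (map names φs)
      marginals⊆φs X∈ = ∈-⋃-concatMap⁺ (Any.map proj₁ (∈-⋃-marginals⁻ is X∈))

      right⊆left : names (marginal (marginals is) 𝕁) ⊆ names (marginal φs 𝕁)
      right⊆left X∈ with ∈-marginal⁻ (marginals is) 𝕁 X∈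
      ... | X∈ms , X∈𝕁 = ∈-marginal⁺ φs 𝕁 (marginals⊆φs X∈ms) X∈𝕁

      -- A name that survives in member `i` and is private in member `j` contradicts privacy if `i`
      -- and `j` coincide, and exclusivity otherwise.
      Out∥In : Disjoint Out In
      Out∥In (X∈Out , X∈In)
        with find (∈-⋃-marginals⁻ is (∖-⊆ (⋃ (map names (marginals is))) 𝕁 X∈Out))
           | find (∈-concatMap⁻ private-names {xs = is} X∈In)
      ... | i , i∈is , X∈Nᵢ , X∈Kᵢ | j , j∈is , X∈j with ∈-AllPairs₂ excl i∈is j∈is
      ...   | inj₁ refl              = proj₂ (∈∖⁻ (scope j) (𝕂 j) X∈j) X∈Kᵢ
      ...   | inj₂ (inj₁ (_ , j∥i)) = j∥i (X∈j , X∈Nᵢ)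
      ...   | inj₂ (inj₂ (j∥i , _)) = j∥i (X∈j , X∈Nᵢ)

      split : ∀ {X} → X ∈ˢ ⋃ (map names φs) ∖ 𝕁 → X ∈ Out ++ In
      split {X} X∈ with ∈∖⁻ (⋃ (map names φs)) 𝕁 X∈
      ... | X∈φs , X∉𝕁 with find (∈-⋃-concatMap⁻ is X∈φs)
      -- Visible in `i`, the name survives into the marginal of `i` and is summed out last;
      -- otherwise it is private to `i`.
      ...   | i , i∈is , X∈i with X ∈? elements (𝕂 i)
      ...     | yes X∈Kᵢ =
        ∈-++⁺ˡ (∈∖⁺ (⋃ (map names (marginals is))) 𝕁 (∈-⋃-marginals⁺ (lose i∈is (X∈i , X∈Kᵢ))) X∉𝕁)
      ...     | no  X∉Kᵢ =
        ∈-++⁺ʳ Out (∈-concatMap⁺ private-names (lose i∈is (∈∖⁺ (scope i) (𝕂 i) X∈i X∉Kᵢ)))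

      join : ∀ {X} → X ∈ Out ++ In → X ∈ˢ ⋃ (map names φs) ∖ 𝕁
      join {X} X∈ with ∈-++⁻ Out X∈
      ... | inj₁ X∈Out with ∈∖⁻ (⋃ (map names (marginals is))) 𝕁 X∈Out
      ...   | X∈ms , X∉𝕁 = ∈∖⁺ (⋃ (map names φs)) 𝕁 (marginals⊆φs X∈ms) X∉𝕁
      -- A private name cannot lie in `𝕁`, since `𝕁-visible` would make it visible in its own
      -- member.
      join {X} X∈ | inj₂ X∈In with find (∈-concatMap⁻ private-names {xs = is} X∈In)
      ...   | i , i∈is , X∈i with ∈∖⁻ (scope i) (𝕂 i) X∈i
      ...     | X∈Nᵢ , X∉Kᵢ =
        ∈∖⁺ (⋃ (map names φs)) 𝕁 (∈-⋃-concatMap⁺ (lose i∈is X∈Nᵢ)) (X∉Kᵢ ∘ 𝕁-visible i∈is X∈Nᵢ)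

      left↭Out++In : elements (⋃ (map names φs) ∖ 𝕁) ↭ Out ++ In
      left↭Out++In =
        unique⇒↭ (unique (⋃ (map names φs) ∖ 𝕁))
                 (Unique.++⁺ (unique (⋃ (map names (marginals is)) ∖ 𝕁)) (private-names-! excl) Out∥In)
                 split join

      eq : ∀ ρ → eval (marginal φs 𝕁) ρ ≈ eval (marginal (marginals is) 𝕁) ρ
      eq ρ = begin
        eval (marginal φs 𝕁) ρ
          ≡⟨ eval-marginal φs 𝕁 ρ ⟩
        margs (elements (⋃ (map names φs) ∖ 𝕁)) (eval (⨀ φs)) ρ
          ≈⟨ margs-↭ (eval-dependsOn (⨀ φs)) left↭Out++In ρ ⟩
        margs (Out ++ In) (eval (⨀ φs)) ρ
          ≡⟨ cong (λ F → F ρ) (foldr-++ marg (eval (⨀ φs)) Out In) ⟩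
        margs Out (margs In (eval (⨀ φs))) ρ
          ≈⟨ margs-cong Out (eval-⨀-marginals excl) ρ ⟨
        margs Out (eval (⨀ (marginals is))) ρ
          ≡⟨ eval-marginal (marginals is) 𝕁 ρ ⟨
        eval (marginal (marginals is) 𝕁) ρ ∎

open Defs using (names; ∑; ⨀; ⋃-names-∖-⊆-⨀; _≋_)
open Factorisation ℝ≥0 using (marginal; marginals; marginal-marginals; Exclusive)

-- Names occurring in contexts and types

occ-lookup⁺ : ∀ {n} (Θ : Ctx n) x {X} → X ∈ occᵖ (lookup Θ x) → X ∈ occᶜ Θ
occ-lookup⁺ (P ∷ Θ) zero    X∈P = ∈-++⁺ˡ X∈P
occ-lookup⁺ (P ∷ Θ) (suc x) X∈Θ = ∈-++⁺ʳ (occᵖ P) (occ-lookup⁺ Θ x X∈Θ)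

occ-lookup⁻ : ∀ {n} (Θ : Ctx n) {X} → X ∈ occᶜ Θ → ∃ λ x → X ∈ occᵖ (lookup Θ x)
occ-lookup⁻ (P ∷ Θ) X∈ with ∈-++⁻ (occᵖ P) X∈
... | inj₁ X∈P = zero , X∈P
... | inj₂ X∈Θ with x , X∈x ← occ-lookup⁻ Θ X∈Θ = suc x , X∈x

occᵗˢ-++ : ∀ As {Bs} → occᵗˢ (As ++ Bs) ≡ occᵗˢ As ++ occᵗˢ Bs
occᵗˢ-++ []       = refl
occᵗˢ-++ (A ∷ As) = trans (cong (occᵗ A ++_) (occᵗˢ-++ As)) (sym (++-assoc (occᵗ A) (occᵗˢ As) _))

occ-concat⁻ : ∀ Ass {X} → X ∈ occᵗˢ (concat Ass) → Any (λ As → X ∈ occᵗˢ As) Ass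
occ-concat⁻ (As ∷ Ass) {X} X∈ with ∈-++⁻ (occᵗˢ As) (subst (X ∈_) (occᵗˢ-++ As) X∈)
... | inj₁ X∈As  = here X∈As
... | inj₂ X∈Ass = there (occ-concat⁻ Ass X∈Ass)

mutual

  occ-≈ᵖ : ∀ {P Q X} → P ≈ᵖ Q → X ∈ occᵖ P → X ∈ occᵖ Q
  occ-≈ᵖ ground       X∈ = X∈
  occ-≈ᵖ (multiset p) X∈ = occ-↭ p X∈

  occ-≈ᵗ : ∀ {A B X} → A ≈ᵗ B → X ∈ occᵗ A → X ∈ occᵗ B
  occ-≈ᵗ (pos P≈Q) X∈ = occ-≈ᵖ P≈Q X∈
  occ-≈ᵗ (_⊸_ {P} {Q} P≈Q A≈B) X∈ with ∈-++⁻ (occᵖ P) X∈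
  ... | inj₁ X∈P = ∈-++⁺ˡ (occ-≈ᵖ P≈Q X∈P)
  ... | inj₂ X∈A = ∈-++⁺ʳ (occᵖ Q) (occ-≈ᵗ A≈B X∈A)

  occ-pointwise : ∀ {As Bs X} → Pointwise _≈ᵗ_ As Bs → X ∈ occᵗˢ As → X ∈ occᵗˢ Bs
  occ-pointwise (_∷_ {A} {B} A≈B As≈Bs) X∈ with ∈-++⁻ (occᵗ A) X∈
  ... | inj₁ X∈A  = ∈-++⁺ˡ (occ-≈ᵗ A≈B X∈A)
  ... | inj₂ X∈As = ∈-++⁺ʳ (occᵗ B) (occ-pointwise As≈Bs X∈As)

  occ-↭ : ∀ {As Bs X} → Permutation _≈ᵗ_ As Bs → X ∈ occᵗˢ As → X ∈ occᵗˢ Bs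
  occ-↭ (Permutation.refl As≈Bs) X∈ = occ-pointwise As≈Bs X∈
  occ-↭ (Permutation.prep {x = A} {B} A≈B p) X∈ with ∈-++⁻ (occᵗ A) X∈
  ... | inj₁ X∈A  = ∈-++⁺ˡ (occ-≈ᵗ A≈B X∈A)
  ... | inj₂ X∈As = ∈-++⁺ʳ (occᵗ B) (occ-↭ p X∈As)
  occ-↭ (Permutation.swap {x = A} {B} {A′} {B′} A≈A′ B≈B′ p) X∈ with ∈-++⁻ (occᵗ A) X∈
  ... | inj₁ X∈A = ∈-++⁺ʳ (occᵗ B′) (∈-++⁺ˡ (occ-≈ᵗ A≈A′ X∈A))
  ... | inj₂ X∈BAs with ∈-++⁻ (occᵗ B) X∈BAs
  ...   | inj₁ X∈B  = ∈-++⁺ˡ (occ-≈ᵗ B≈B′ X∈B)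
  ...   | inj₂ X∈As = ∈-++⁺ʳ (occᵗ B′) (∈-++⁺ʳ (occᵗ A′) (occ-↭ p X∈As))
  occ-↭ (Permutation.trans p q) X∈ = occ-↭ q (occ-↭ p X∈)

-- A ground type counts as the union of an empty list too, where its names would be lost; hence the
-- demand for at least one summand.
occ-≈⨄ : ∀ {P Ps X} → P ≈⨄ Ps → 1 ≤ length Ps → X ∈ occᵖ P → Any (λ Q → X ∈ occᵖ Q) Ps
occ-≈⨄ (ground (refl ∷ _))          _ X∈ = here X∈
occ-≈⨄ (multiset {Ass = Ass} refl p) _ X∈ = Any.map⁺ (occ-concat⁻ Ass (occ-↭ p X∈))

occ-≈⨄ᶜ : ∀ {n} (Θ : Ctx n) Θs → Θ ≈⨄ᶜ Θs → 1 ≤ length Θs →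
          ∀ {X} → X ∈ occᶜ Θ → Any (λ Θᵢ → X ∈ occᶜ Θᵢ) Θs
occ-≈⨄ᶜ Θ (_ ∷ _) Θ≈ _ X∈ with occ-lookup⁻ Θ X∈
... | x , X∈x = Any.map (λ {Θᵢ} → occ-lookup⁺ Θᵢ x) (Any.map⁻ (occ-≈⨄ (Θ≈ x) (s≤s z≤n) X∈x))

-- Premises and their components

SomeTree : Set
SomeTree = ∃ Tree

trees : ∀ {n} {t : Term n} {Θs As} → Trees t Θs As → List SomeTree
trees []       = []
trees (π ∷ πs) = (_ , π) ∷ trees πs

-- The premises stripped of their naming proofs, so that the case analyses on rules below involve
-- trees only.
subtrees : ∀ {J} → Tree J → List SomeTree
subtrees (i-sample _ _ _ _)       = []
subtrees (i-cond _ _ _ _ _ _ _ _) = []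
subtrees (i-var _ _ _)            = []
subtrees (i-let π₁ π₂ _ _)        = (_ , π₁) ∷ (_ , π₂) ∷ []
subtrees (i-pair _ π₁ π₂)         = (_ , π₁) ∷ (_ , π₂) ∷ []
subtrees (i-letp π₁ π₂)           = (_ , π₁) ∷ (_ , π₂) ∷ []
subtrees (i-abs π₁)               = (_ , π₁) ∷ []
subtrees (i-app π₁ π₂ _ _)        = (_ , π₁) ∷ (_ , π₂) ∷ []
subtrees (i-bang πs _)            = trees πs
subtrees (i-der π₁)               = (_ , π₁) ∷ []

forget : SomeDerivation → SomeTree
forget (J , π) = J , tree π

mutual

  -- The function by which premises handles i-bang is private to its module;
  -- premises-bang determines it by unification.
  bang-premises : ∀ {n} {t : Term n} {Θs As} (πs : Trees t Θs As) → DistinctMainNames (axiomsˢ πs) →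
                  List SomeDerivation
  bang-premises = _

  premises-bang : ∀ {n} {Θ : Ctx n} {Θs t As} (πs : Trees t Θs As) (Θ≈ : Θ ≈⨄ᶜ Θs) d →
                  premises (i-bang {Θ = Θ} πs Θ≈ ,! d) ≡ bang-premises πs d
  premises-bang πs Θ≈ d = refl

forget-bang-premises : ∀ {n} {t : Term n} {Θs As} (πs : Trees t Θs As) d →
                       map forget (bang-premises πs d) ≡ trees πs
forget-bang-premises []       d = refl
forget-bang-premises (π ∷ πs) d = cong (_ ∷_) (forget-bang-premises πs (proj₂ (distinct-++⁻ (axioms π) d)))

forget-premises : ∀ {J} (π : Derivation J) → map forget (premises π) ≡ subtrees (tree π)
forget-premises (i-sample _ _ _ _ ,! _)        = refl
forget-premises (i-cond _ _ _ _ _ _ _ _ ,! _)  = refl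
forget-premises (i-var _ _ _ ,! _)             = refl
forget-premises (i-let _ _ _ _ ,! _)           = refl
forget-premises (i-pair _ _ _ ,! _)            = refl
forget-premises (i-letp _ _ ,! _)              = refl
forget-premises (i-abs _ ,! _)                 = refl
forget-premises (i-app _ _ _ _ ,! _)           = refl
forget-premises (i-bang πs _ ,! d)             = forget-bang-premises πs d
forget-premises (i-der _ ,! _)                 = refl

length-subtrees : ∀ {J} (π : Derivation J) → length (premises π) ≡ length (subtrees (tree π))
length-subtrees π = trans (sym (length-map forget (premises π))) (cong length (forget-premises π))

axiomsˢ-trees : ∀ {n} {t : Term n} {Θs As} (πs : Trees t Θs As) →
                axiomsˢ πs ≡ concatMap (axioms ∘ proj₂) (trees πs)
axiomsˢ-trees []       = refl
axiomsˢ-trees (π ∷ πs) = cong (axioms π ++_) (axiomsˢ-trees πs)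

-- A rule with premises adds no factor of its own. The bound excludes the probabilistic axioms,
-- which do.
axioms-subtrees : ∀ {J} (π : Tree J) → 1 ≤ length (subtrees π) →
                  axioms π ≡ concatMap (axioms ∘ proj₂) (subtrees π)
axioms-subtrees (i-let π₁ π₂ _ _) _ = cong (axioms π₁ ++_) (sym (++-identityʳ (axioms π₂)))
axioms-subtrees (i-pair _ π₁ π₂)  _ = cong (axioms π₁ ++_) (sym (++-identityʳ (axioms π₂)))
axioms-subtrees (i-letp π₁ π₂)    _ = cong (axioms π₁ ++_) (sym (++-identityʳ (axioms π₂)))
axioms-subtrees (i-abs π₁)        _ = sym (++-identityʳ (axioms π₁))
axioms-subtrees (i-app π₁ π₂ _ _) _ = cong (axioms π₁ ++_) (sym (++-identityʳ (axioms π₂)))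
axioms-subtrees (i-bang πs _)     _ = axiomsˢ-trees πs
axioms-subtrees (i-der π₁)        _ = sym (++-identityʳ (axioms π₁))

Cpts-premises : ∀ {J} (π : Derivation J) → 1 ≤ length (premises π) →
                Cpts π ≡ concatMap (λ πᵢ → Cpts (proj₂ πᵢ)) (premises π)
Cpts-premises π n≥1 = begin
  map factor (axioms (tree π))
    ≡⟨ cong (map factor) (axioms-subtrees (tree π) (subst (1 ≤_) (length-subtrees π) n≥1)) ⟩
  map factor (concatMap (axioms ∘ proj₂) (subtrees (tree π)))
    ≡⟨ cong (map factor ∘ concatMap (axioms ∘ proj₂)) (forget-premises π) ⟨
  map factor (concatMap (axioms ∘ proj₂) (map forget (premises π)))
    ≡⟨ cong (map factor) (concatMap-map (axioms ∘ proj₂) forget (premises π)) ⟩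
  map factor (concatMap (λ πᵢ → axioms (tree (proj₂ πᵢ))) (premises π))
    ≡⟨ map-concatMap factor (λ πᵢ → axioms (tree (proj₂ πᵢ))) (premises π) ⟩
  concatMap (λ πᵢ → Cpts (proj₂ πᵢ)) (premises π) ∎
  where open ≡-Reasoning

-- Names of the conclusion in the premises

occ-trees-ctx : ∀ {n} {t : Term n} {Θs As X} (πs : Trees t Θs As) →
            Any (λ Θ → X ∈ occᶜ Θ) Θs → Any (λ (J , _) → X ∈ Occ J) (trees πs)
occ-trees-ctx (π ∷ πs) (here X∈Θ)   = here (∈-++⁺ˡ X∈Θ)
occ-trees-ctx (π ∷ πs) (there X∈Θs) = there (occ-trees-ctx πs X∈Θs)

occ-trees-type : ∀ {n} {t : Term n} {Θs As X} (πs : Trees t Θs As) →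
             X ∈ occᵗˢ As → Any (λ (J , _) → X ∈ Occ J) (trees πs)
occ-trees-type {Θs = Θ ∷ _} {A ∷ _} (π ∷ πs) X∈ with ∈-++⁻ (occᵗ A) X∈
... | inj₁ X∈A  = here (∈-++⁺ʳ (occᶜ Θ) X∈A)
... | inj₂ X∈As = there (occ-trees-type πs X∈As)

length-trees : ∀ {n} {t : Term n} {Θs As} (πs : Trees t Θs As) → length (trees πs) ≡ length Θs
length-trees []       = refl
length-trees (π ∷ πs) = cong ℕ.suc (length-trees πs)

-- From premises to conclusion no rule introduces a name. The bound excludes axioms and the empty
-- `i-bang`, whose ground context has no premise to occur in.
occ-subtrees : ∀ {J X} (π : Tree J) → 1 ≤ length (subtrees π) →
               X ∈ Occ J → Any (λ (Jᵢ , _) → X ∈ Occ Jᵢ) (subtrees π)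
occ-subtrees (i-let {Θ = Θ} {Θ₁} {Θ₂} {P′ = P′} π₁ π₂ _ Θ≈) _ X∈ with ∈-++⁻ (occᶜ Θ) X∈
... | inj₂ X∈A = there (here (∈-++⁺ʳ (occᶜ (P′ ∷ Θ₂)) X∈A))
... | inj₁ X∈Θ with occ-≈⨄ᶜ Θ (Θ₁ ∷ Θ₂ ∷ []) Θ≈ (s≤s z≤n) X∈Θ
...   | here X∈Θ₁         = here (∈-++⁺ˡ X∈Θ₁)
...   | there (here X∈Θ₂) = there (here (∈-++⁺ˡ (∈-++⁺ʳ (occᵖ P′) X∈Θ₂)))
occ-subtrees (i-pair {Θ = Θ} {L₁ = L₁} _ π₁ π₂) _ X∈ with ∈-++⁻ (occᶜ Θ) X∈
... | inj₁ X∈Θ = here (∈-++⁺ˡ X∈Θ)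
... | inj₂ X∈L with ∈-++⁻ (occᵍ L₁) X∈L
...   | inj₁ X∈L₁ = here (∈-++⁺ʳ (occᶜ Θ) X∈L₁)
...   | inj₂ X∈L₂ = there (here (∈-++⁺ʳ (occᶜ Θ) X∈L₂))
occ-subtrees (i-letp {Θ = Θ} {L₁ = L₁} {L₂} π₁ π₂) _ X∈ with ∈-++⁻ (occᶜ Θ) X∈
... | inj₁ X∈Θ = there (here (∈-++⁺ˡ (∈-++⁺ʳ (occᵍ L₂) (∈-++⁺ʳ (occᵍ L₁) X∈Θ))))
... | inj₂ X∈A = there (here (∈-++⁺ʳ (occᶜ (ground L₂ ∷ ground L₁ ∷ Θ)) X∈A))
occ-subtrees (i-abs {Θ = Θ} {P = P} π₁) _ X∈ with ∈-++⁻ (occᶜ Θ) X∈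
... | inj₁ X∈Θ = here (∈-++⁺ˡ (∈-++⁺ʳ (occᵖ P) X∈Θ))
... | inj₂ X∈P⊸A with ∈-++⁻ (occᵖ P) X∈P⊸A
...   | inj₁ X∈P = here (∈-++⁺ˡ (∈-++⁺ˡ X∈P))
...   | inj₂ X∈A = here (∈-++⁺ʳ (occᶜ (P ∷ Θ)) X∈A)
occ-subtrees (i-app {Θ = Θ} {Θ₁} {Θ₂} {P = P} π₁ π₂ _ Θ≈) _ X∈ with ∈-++⁻ (occᶜ Θ) X∈
... | inj₂ X∈A = here (∈-++⁺ʳ (occᶜ Θ₁) (∈-++⁺ʳ (occᵖ P) X∈A))
... | inj₁ X∈Θ with occ-≈⨄ᶜ Θ (Θ₁ ∷ Θ₂ ∷ []) Θ≈ (s≤s z≤n) X∈Θ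
...   | here X∈Θ₁         = here (∈-++⁺ˡ X∈Θ₁)
...   | there (here X∈Θ₂) = there (here (∈-++⁺ˡ X∈Θ₂))
occ-subtrees (i-bang {Θ = Θ} {Θs} πs Θ≈) n≥1 X∈ with ∈-++⁻ (occᶜ Θ) X∈
... | inj₁ X∈Θ  = occ-trees-ctx πs (occ-≈⨄ᶜ Θ Θs Θ≈ (subst (1 ≤_) (length-trees πs) n≥1) X∈Θ)
... | inj₂ X∈As = occ-trees-type πs X∈As
occ-subtrees (i-der {Θ = Θ} π₁) _ X∈ with ∈-++⁻ (occᶜ Θ) X∈
... | inj₁ X∈Θ = here (∈-++⁺ˡ X∈Θ)
... | inj₂ X∈A = here (∈-++⁺ʳ (occᶜ Θ) (∈-++⁺ˡ X∈A))

occ-premises : ∀ {J X} (π : Derivation J) → 1 ≤ length (premises π) →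
               X ∈ Occ J → Any (λ (Jᵢ , _) → X ∈ Occ Jᵢ) (premises π)
occ-premises {X = X} π n≥1 X∈ =
  Any.map⁻ (subst (Any _) (sym (forget-premises π))
    (occ-subtrees (tree π) (subst (1 ≤_) (length-subtrees π) n≥1) X∈))

-- Names of the component factors

mutual

  factor-names⊆OccTree : ∀ {J X} (π : Tree J) → Any (λ a → X ∈ˢ names (factor a)) (axioms π) → X ∈ OccTree π
  factor-names⊆OccTree (i-sample {Θ = Θ} d Z _ _) (here X∈) =
    ∈-++⁺ˡ (∈-++⁺ʳ (occᶜ Θ) (∈⌈⌉⁻ (Z ∷ []) X∈))
  factor-names⊆OccTree {X = X} (i-cond {Θ = Θ} ys Ys d Z _ y:Y _ _) (here X∈)
    with ∈-++⁻ (elements ⌈ toList Ys ⌉) (∈⌈⌉⁻ (elements ⌈ toList Ys ⌉ ++ elements ⌈ Z ∷ [] ⌉) X∈)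
  ... | inj₂ X∈Z = ∈-++⁺ˡ (∈-++⁺ʳ (occᶜ Θ) (∈⌈⌉⁻ (Z ∷ []) X∈Z))
  -- The conditioning names are not in the type of the axiom; they occur in its context as the types
  -- of the tested variables.
  ... | inj₁ X∈Ys = ∈-++⁺ˡ (∈-++⁺ˡ (occ-lookup⁺ Θ (lookup ys i) (subst (λ P → X ∈ occᵖ P) (sym (y:Y i)) X∈Yᵢ)))
    where
    X∈Ys′ = ∈-toList⁻ (∈⌈⌉⁻ (toList Ys) X∈Ys)
    i     = VecAny.index X∈Ys′
    X∈Yᵢ : X ∈ lookup Ys i ∷ []
    X∈Yᵢ = here (VecAny.lookup-index X∈Ys′)
  factor-names⊆OccTree {J} (i-let π₁ π₂ _ _) X∈ = ∈-++⁺ʳ (Occ J) (factor-names⊆OccTree₂ π₁ π₂ X∈)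
  factor-names⊆OccTree {J} (i-pair _ π₁ π₂)  X∈ = ∈-++⁺ʳ (Occ J) (factor-names⊆OccTree₂ π₁ π₂ X∈)
  factor-names⊆OccTree {J} (i-letp π₁ π₂)    X∈ = ∈-++⁺ʳ (Occ J) (factor-names⊆OccTree₂ π₁ π₂ X∈)
  factor-names⊆OccTree {J} (i-abs π₁)        X∈ = ∈-++⁺ʳ (Occ J) (factor-names⊆OccTree π₁ X∈)
  factor-names⊆OccTree {J} (i-app π₁ π₂ _ _) X∈ = ∈-++⁺ʳ (Occ J) (factor-names⊆OccTree₂ π₁ π₂ X∈)
  factor-names⊆OccTree {J} (i-bang πs _)     X∈ = ∈-++⁺ʳ (Occ J) (factor-names⊆OccTrees πs X∈)
  factor-names⊆OccTree {J} (i-der π₁)        X∈ = ∈-++⁺ʳ (Occ J) (factor-names⊆OccTree π₁ X∈)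

  factor-names⊆OccTree₂ : ∀ {J₁ J₂ X} (π₁ : Tree J₁) (π₂ : Tree J₂) →
    Any (λ a → X ∈ˢ names (factor a)) (axioms π₁ ++ axioms π₂) → X ∈ OccTree π₁ ++ OccTree π₂
  factor-names⊆OccTree₂ π₁ π₂ X∈ with Any.++⁻ (axioms π₁) X∈
  ... | inj₁ X∈₁ = ∈-++⁺ˡ (factor-names⊆OccTree π₁ X∈₁)
  ... | inj₂ X∈₂ = ∈-++⁺ʳ (OccTree π₁) (factor-names⊆OccTree π₂ X∈₂)

  factor-names⊆OccTrees : ∀ {n} {t : Term n} {Θs As X} (πs : Trees t Θs As) →
    Any (λ a → X ∈ˢ names (factor a)) (axiomsˢ πs) → X ∈ OccTrees πs
  factor-names⊆OccTrees (π ∷ πs) X∈ with Any.++⁻ (axioms π) X∈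
  ... | inj₁ X∈₁ = ∈-++⁺ˡ (factor-names⊆OccTree π X∈₁)
  ... | inj₂ X∈₂ = ∈-++⁺ʳ (OccTree π) (factor-names⊆OccTrees πs X∈₂)

Cpts-names⊆Nmᵈ : ∀ {J} (π : Derivation J) → ⋃ (map names (Cpts π)) ⊆ Nmᵈ π
Cpts-names⊆Nmᵈ π X∈ =
  ∈⌈⌉⁺ (OccTree (tree π)) (factor-names⊆OccTree (tree π) (Any.map⁻ (∈⋃-map⁻ names (Cpts π) X∈)))

Nm⊆Nmᵈ : ∀ {J} (π : Derivation J) → Nm J ⊆ Nmᵈ π
Nm⊆Nmᵈ {J} π X∈ = ∈⌈⌉⁺ (OccTree (tree π)) (∈-++⁺ˡ (∈⌈⌉⁻ (Occ J) X∈))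

-- Compatibility and the decomposition

Hides : SomeDerivation → SomeDerivation → Set
Hides (Jᵢ , πᵢ) (_ , πⱼ) = ∀ {X} → X ∈ˢ Nmᵈ πᵢ → X ∉ˢ Nm Jᵢ → X ∉ˢ Nmᵈ πⱼ

-- Reading the list as the tabulation of its own lookup turns a condition on distinct positions into
-- one on pairs of entries.
compatible⇒hides : ∀ πs → Compatible πs → AllPairs (λ πᵢ πⱼ → Hides πᵢ πⱼ × Hides πⱼ πᵢ) πs
compatible⇒hides πs compatible =
  subst (AllPairs _) (tabulate-lookup πs)
    (AllPairs.tabulate⁺ λ {i} {j} i≢j →
      (λ X∈ X∉ → compatible _ i X∈ X∉ j (i≢j ∘ sym)) , (λ X∈ X∉ → compatible _ j X∈ X∉ i i≢j))

proposition6p7 : ∀ {J} (π : Derivation J) →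
    1 ≤ length (premises π) →
    Compatible (premises π) →
    ⟦ π ⟧ ≋ ∑ (⋃ (map names ⟦ premises π ⟧ˢ) ∖ Nm J) (⨀ ⟦ premises π ⟧ˢ)
    (⋃-names-∖-⊆-⨀ ⟦ premises π ⟧ˢ (Nm J))
proposition6p7 {J} π n≥1 compatible =
  -- The components of `π` are replaced by the concatenated components of its premises, which is the
  -- form that `marginal-marginals` treats.
  subst (λ φs → marginal φs (Nm J) ≋ marginal ⟦ premises π ⟧ˢ (Nm J)) (sym (Cpts-premises π n≥1))
    (marginal-marginals Φ 𝕂 (Nm J) (AllPairs.map (λ {πᵢ πⱼ} → exclusive {πᵢ} {πⱼ}) hides) visible)
  where
  Φ = λ (πᵢ : SomeDerivation) → Cpts (proj₂ πᵢ)
  𝕂 = λ (πᵢ : SomeDerivation) → Nm (proj₁ πᵢ)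

  hides : AllPairs (λ πᵢ πⱼ → Hides πᵢ πⱼ × Hides πⱼ πᵢ) (premises π)
  hides = compatible⇒hides (premises π) compatible

  disjoint : ∀ {πᵢ πⱼ} → Hides πᵢ πⱼ →
             Disjoint (elements (⋃ (map names (Φ πᵢ)) ∖ 𝕂 πᵢ)) (elements (⋃ (map names (Φ πⱼ))))
  disjoint {Jᵢ , πᵢ} {_ , πⱼ} hide (X∈i , X∈j) with ∈∖⁻ (⋃ (map names (Cpts πᵢ))) (Nm Jᵢ) X∈i
  ... | X∈πᵢ , X∉Jᵢ = hide (Cpts-names⊆Nmᵈ πᵢ X∈πᵢ) X∉Jᵢ (Cpts-names⊆Nmᵈ πⱼ X∈j)

  exclusive : ∀ {πᵢ πⱼ} → Hides πᵢ πⱼ × Hides πⱼ πᵢ → Exclusive Φ 𝕂 πᵢ πⱼ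
  exclusive {πᵢ} {πⱼ} (i , j) = disjoint {πᵢ} {πⱼ} i , disjoint {πⱼ} {πᵢ} j

  visible : ∀ {πᵢ X} → πᵢ ∈ premises π → X ∈ˢ ⋃ (map names (Φ πᵢ)) → X ∈ˢ Nm J → X ∈ˢ 𝕂 πᵢ
  visible {Jᵢ , πᵢ} {X} i∈ X∈πᵢ X∈J = decidable-stable (X ∈? elements (Nm Jᵢ)) λ X∉Jᵢ →
    let X∈Nmᵈ = Cpts-names⊆Nmᵈ πᵢ X∈πᵢ
        -- Some premise shows `X` in its conclusion. If it is `πᵢ`, then `X` is visible there; if
        -- not, compatibility bars a name hidden by `πᵢ` from it.
        (Jⱼ , πⱼ) , j∈ , X∈Occⱼ = find (occ-premises π n≥1 (∈⌈⌉⁻ (Occ J) X∈J))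
        X∈Jⱼ = ∈⌈⌉⁺ (Occ Jⱼ) X∈Occⱼ
    in case ∈-AllPairs₂ hides i∈ j∈ of λ where
      (inj₁ refl)              → X∉Jᵢ X∈Jⱼ
      (inj₂ (inj₁ (hide , _))) → hide X∈Nmᵈ X∉Jᵢ (Nm⊆Nmᵈ πⱼ X∈Jⱼ)
      (inj₂ (inj₂ (_ , hide))) → hide X∈Nmᵈ X∉Jᵢ (Nm⊆Nmᵈ πⱼ X∈Jⱼ)
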